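{- Let $q$ be a prime power and let $n,d$ be positive integers. Then $$\chi_d(n,q)\ \le\ q^{\left\lceil \log_{q}\left[2+\binom{n-1}{d-1}(q-1)^{d-1}\right]\right\rceil}.$$
   Context: Let $V_n=\mathbb{F}_q^n$ be the set of all length-$n$ vectors over the finite field $\mathbb{F}_q$. The Hamming distance $d_H(\mathbf{x},\mathbf{y})$ between $\mathbf{x},\mathbf{y}\in V_n$ is the number of coordinates in which they differ. A coloring $\Gamma:V_n\to\{1,\dots,L\}$ is called an exactly $d$-distance coloring if $\Gamma(\mathbf{x})\neq\Gamma(\mathbf{y})$ for all $\mathbf{x},\mathbf{y}\in V_n$ with $d_H(\mathbf{x},\mathbf{y})= d$. $\chi_d(n,q)$ denotes the minimum number $L$ of colors for which an exactly $d$-distance coloring of $V_n$ exists. -}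

module Defs where

open import Data.Nat using (ℕ; zero; suc; _+_; _*_; _∸_; _^_; _≤_)
open import Data.Nat.Primality using (Prime)
open import Data.Fin using (Fin; zero; suc)
open import Data.Fin.Properties using (_≟_)
open import Data.Product using (Σ; _×_; ∃-syntax)
open import Relation.Nullary using (¬_; yes; no)
open import Relation.Binary.PropositionalEquality using (_≡_)

IsPrimePower : ℕ → Set
IsPrimePower q = ∃[ p ] ∃[ e ] (Prime p × q ≡ p ^ suc e)

-- V_n over an alphabet of size q (the field F_q, represented by its q elements Fin q)
Word : ℕ → ℕ → Set
Word n q = Fin n → Fin q

hamming : ∀ {n q} → Word n q → Word n q → ℕ
hamming {zero}  x y = 0
hamming {suc n} x y with x zero ≟ y zero
... | yes _ = hamming {n} (λ i → x (suc i)) (λ i → y (suc i))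
... | no  _ = suc (hamming {n} (λ i → x (suc i)) (λ i → y (suc i)))

IsExactDistColoring : (n q d L : ℕ) → (Word n q → Fin L) → Set
IsExactDistColoring n q d L Γ =
  ∀ (x y : Word n q) → hamming x y ≡ d → ¬ (Γ x ≡ Γ y)

-- χ_d(n,q) ≤ L  ⇔  an exactly d-distance coloring with L colors exists
χ≤ : (d n q L : ℕ) → Set
χ≤ d n q L = Σ (Word n q → Fin L) (IsExactDistColoring n q d L)

IsCeilLog : (q m k : ℕ) → Set
IsCeilLog q m k = (m ≤ q ^ k) × (∀ j → m ≤ q ^ j → k ≤ j)

{-# OPTIONS --safe #-}
-- Colour x by its syndrome Σ xᵢ hᵢ ∈ F^k, where F is the field with q elements; this works as soon
-- as no combination of exactly d columns with nonzero coefficients vanishes.  The columns are chosen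
-- greedily: a new column must avoid the combinations of exactly d − 1 of the previous ones, of which
-- there are at most C(n − 1, d − 1) (q − 1)^(d − 1) < q^k.
--
-- For q = p^e the field F is cut out of the group ring R = (ℤ/p)[ξ] / (ξ^(q − 1) − 1).  By Frobenius
-- y^q = y in R, so each y^(q − 1) is idempotent.  The element t = ∏ (ξ^(p^j − 1) − 1), 1 ≤ j < e, is
-- nonzero by degree, and a primitive idempotent ε below t^(q − 1) makes F = εR a field in which
-- ξ^(p^j) ≠ ξ for 1 ≤ j < e.  If the powers ξ^0, …, ξ^(r − 1) form a basis of F over ℤ/p, then
-- p^r ≤ q because every element is a root of y^q − y, and ξ^(p^r) = ξ by Lagrange; so r = e.
module Submission where

-- Hamming distance sees only whether letters agree, so any bijection of `Fin q` with a field of q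
-- elements may carry the letters over, and most of the work lies in producing such a field. The
-- group ring makes it possible to do so without an irreducible polynomial of degree e, and its
-- order q - 1 makes ξ^q = ξ automatic. The price is a choice among many residue fields, down to ℤ/p
-- at ξ = 1. The factor t singles out the large ones, since it vanishes in every residue field where
-- ξ lies in a too small subfield. The degree of t is the sum of the numbers p^j - 1, which stays
-- below q - 1, so the relation ξ^(q - 1) = 1 never comes into play when t is multiplied out.
-- Everything is finite with decidable equality, so the idempotent and the basis are both found by
-- terminating searches. The exponent e of the overview is `suc e` in the code, so there the product
-- t runs over 1 ≤ j ≤ `e`.

module Frobenius where

  open import Algebra.Bundles using (CommutativeRing)
  open import Data.Nat using (ℕ; zero; suc; _≤_; _<_; z<s; s<s)
  import Data.Nat as ℕ
  import Data.Nat.Properties as ℕ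
  open import Data.Nat.Combinatorics using (_C_; nCk+nC[k+1]≡[n+1]C[k+1]; k>n⇒nCk≡0; nCn≡1)
  open import Data.Nat.Divisibility using (_∣_; divides; ∣⇒≤; m∣m*n)
  open import Data.Nat.Primality using (Prime; euclidsLemma; prime)
  open import Data.Fin using (Fin; zero; suc; toℕ; fromℕ; inject₁)
  open import Data.Fin.Properties using (toℕ-fromℕ; toℕ-inject₁; toℕ<n)
  open import Data.Product using (_,_; _×_)
  open import Data.Sum using (inj₁; inj₂)
  open import Relation.Nullary using (contradiction)
  open import Relation.Binary.PropositionalEquality as ≡ using (_≡_)
  open import Level using (0ℓ)

  -- Binomial coefficients modulo a prime.

  absorption : ∀ n k → suc k ℕ.* (suc n C suc k) ≡ suc n ℕ.* (n C k)
  absorption zero zero = ≡.refl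
  absorption zero (suc k) = ≡.trans
    (≡.cong (suc (suc k) ℕ.*_) (k>n⇒nCk≡0 {1} {suc (suc k)} (s<s z<s)))
    (≡.trans (ℕ.*-zeroʳ (suc (suc k)))
    (≡.sym (≡.trans (ℕ.*-identityˡ _) (k>n⇒nCk≡0 {0} {suc k} z<s))))
  absorption (suc n) zero = begin
    1 ℕ.* (suc (suc n) C 1)                       ≡⟨ ℕ.*-identityˡ _ ⟩
    suc (suc n) C 1                               ≡⟨ nCk+nC[k+1]≡[n+1]C[k+1] (suc n) 0 ⟨
    1 ℕ.+ (suc n C 1)                             ≡⟨ ≡.cong (1 ℕ.+_) (≡.trans (≡.sym (ℕ.*-identityˡ _)) (absorption n 0)) ⟩
    1 ℕ.+ suc n ℕ.* 1                             ≡⟨⟩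
    suc (suc n) ℕ.* 1                             ∎
    where open ≡.≡-Reasoning
  absorption (suc n) (suc k) = begin
    suc (suc k) ℕ.* (suc (suc n) C suc (suc k))
      ≡⟨ ≡.cong (suc (suc k) ℕ.*_) (nCk+nC[k+1]≡[n+1]C[k+1] (suc n) (suc k)) ⟨
    suc (suc k) ℕ.* (a ℕ.+ (suc n C suc (suc k)))
      ≡⟨ ℕ.*-distribˡ-+ (suc (suc k)) a _ ⟩
    (a ℕ.+ suc k ℕ.* a) ℕ.+ suc (suc k) ℕ.* (suc n C suc (suc k))
      ≡⟨ ≡.cong₂ (λ u v → (a ℕ.+ u) ℕ.+ v) (absorption n k) (absorption n (suc k)) ⟩
    (a ℕ.+ suc n ℕ.* (n C k)) ℕ.+ suc n ℕ.* (n C suc k)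
      ≡⟨ ℕ.+-assoc a _ _ ⟩
    a ℕ.+ (suc n ℕ.* (n C k) ℕ.+ suc n ℕ.* (n C suc k))
      ≡⟨ ≡.cong (a ℕ.+_) (ℕ.*-distribˡ-+ (suc n) (n C k) _) ⟨
    a ℕ.+ suc n ℕ.* ((n C k) ℕ.+ (n C suc k))
      ≡⟨ ≡.cong (λ u → a ℕ.+ suc n ℕ.* u) (nCk+nC[k+1]≡[n+1]C[k+1] n k) ⟩
    suc (suc n) ℕ.* a ∎
    where
    open ≡.≡-Reasoning
    a = suc n C suc k

  -- By `absorption` the prime, here `suc p`, divides the product of `suc k` with the binomial
  -- coefficient, and it cannot divide `suc k`, a positive number below it.
  prime∣binomial : ∀ {p k} → Prime (suc p) → k < p → suc p ∣ (suc p C suc k)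
  prime∣binomial {p} {k} pr k<p
    with euclidsLemma (suc k) (suc p C suc k) pr
           (≡.subst (suc p ∣_) (≡.sym (absorption p k)) (m∣m*n (p C k)))
  ... | inj₁ d = contradiction (∣⇒≤ d) (ℕ.<⇒≱ (s<s k<p))
  ... | inj₂ d = d

  -- The Frobenius map in characteristic p, and quotients by annihilators.

  module CharacteristicP (R : CommutativeRing 0ℓ 0ℓ) where
    open CommutativeRing R hiding (zero)
    open import Algebra.Properties.Semiring.Exp semiring
    open import Algebra.Properties.Semiring.Mult semiring renaming (_×_ to _·_)
    open import Algebra.Properties.CommutativeSemiring.Binomial commutativeSemiring
      using (binomialTerm; theorem)
    open import Algebra.Properties.CommutativeMonoid.Sum +-commutativeMonoid
      using (sum; sum-cong-≋; sum-init-last; sum-replicate-zero)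
    open import Relation.Binary.Reasoning.Setoid setoid

    ·-zeroʳ : ∀ n → n · 0# ≈ 0#
    ·-zeroʳ zero = refl
    ·-zeroʳ (suc n) = trans (+-identityˡ _) (·-zeroʳ n)

    ∣⇒·≈0 : ∀ {p} → p · 1# ≈ 0# → ∀ {n} → p ∣ n → ∀ x → n · x ≈ 0#
    ∣⇒·≈0 {p} char (divides m ≡.refl) x = begin
      (m ℕ.* p) · x       ≈⟨ ×-assocˡ x m p ⟨
      m · (p · x)         ≈⟨ ×-congʳ m (×-congʳ p (*-identityˡ x)) ⟨
      m · (p · (1# * x))  ≈⟨ ×-congʳ m (×-assoc-* p 1# x) ⟨
      m · ((p · 1#) * x)  ≈⟨ ×-congʳ m (trans (*-congʳ char) (zeroˡ x)) ⟩
      m · 0#              ≈⟨ ·-zeroʳ m ⟩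
      0#                  ∎

    frobenius-+ : ∀ {p} → Prime p → p · 1# ≈ 0# → ∀ x y → (x + y) ^ p ≈ x ^ p + y ^ p
    frobenius-+ {zero} (prime {{()}} _)
    frobenius-+ {suc p} pr char x y = begin
      (x + y) ^ suc p ≈⟨ theorem (suc p) x y ⟩
      f zero + sum (λ i → f (suc i))
        ≈⟨ +-congˡ (sum-init-last (λ i → f (suc i))) ⟩
      f zero + (sum (λ i → f (suc (inject₁ i))) + f (suc (fromℕ p)))
        ≈⟨ +-cong first (+-cong (trans (sum-cong-≋ middle) (sum-replicate-zero p)) last) ⟩
      y ^ suc p + (0# + x ^ suc p)
        ≈⟨ +-congˡ (+-identityˡ _) ⟩
      y ^ suc p + x ^ suc p ≈⟨ +-comm _ _ ⟩
      x ^ suc p + y ^ suc p ∎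
      where
      f : Fin (suc (suc p)) → Carrier
      f = binomialTerm x y (suc p)
      first : f zero ≈ y ^ suc p
      first = trans (+-identityʳ _) (*-identityˡ _)
      middle : ∀ i → f (suc (inject₁ i)) ≈ 0#
      middle i = ∣⇒·≈0 char
        (≡.subst (λ k → suc p ∣ (suc p C suc k)) (≡.sym (toℕ-inject₁ i)) (prime∣binomial pr (toℕ<n i))) _
      last : f (suc (fromℕ p)) ≈ x ^ suc p
      last = begin
        f (suc (fromℕ p))
          ≈⟨ ×-congˡ (≡.trans (≡.cong (λ k → suc p C suc k) (toℕ-fromℕ p)) (nCn≡1 (suc p))) ⟩
        1 · (x ^ suc (toℕ (fromℕ p)) * y ^ (p ℕ.∸ toℕ (fromℕ p)))
          ≈⟨ +-identityʳ _ ⟩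
        x ^ suc (toℕ (fromℕ p)) * y ^ (p ℕ.∸ toℕ (fromℕ p))
          ≈⟨ *-cong (^-congʳ x (≡.cong suc (toℕ-fromℕ p)))
               (^-congʳ y (≡.trans (≡.cong (p ℕ.∸_) (toℕ-fromℕ p)) (ℕ.n∸n≡0 p))) ⟩
        x ^ suc p * 1#
          ≈⟨ *-identityʳ _ ⟩
        x ^ suc p ∎

    iterated-frobenius-+ : ∀ {p} → Prime p → p · 1# ≈ 0# →
                           ∀ e x y → (x + y) ^ (p ℕ.^ e) ≈ x ^ (p ℕ.^ e) + y ^ (p ℕ.^ e)
    iterated-frobenius-+ pr char zero x y =
      trans (*-identityʳ _) (sym (+-cong (*-identityʳ x) (*-identityʳ y)))
    iterated-frobenius-+ {p} pr char (suc e) x y = begin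
      (x + y) ^ (p ℕ.* q)            ≈⟨ ^-assocʳ (x + y) p q ⟨
      ((x + y) ^ p) ^ q              ≈⟨ ^-congˡ q (frobenius-+ pr char x y) ⟩
      (x ^ p + y ^ p) ^ q            ≈⟨ iterated-frobenius-+ pr char e _ _ ⟩
      (x ^ p) ^ q + (y ^ p) ^ q      ≈⟨ +-cong (^-assocʳ x p q) (^-assocʳ y p q) ⟩
      x ^ (p ℕ.* q) + y ^ (p ℕ.* q)  ∎
      where q = p ℕ.^ e

  -- This is R modulo the annihilator of `a`, which for idempotent `a` is isomorphic to the ring aR
  -- with unit `a`. Coarsening the equality and keeping the carrier avoids representatives and
  -- leaves all operations as they are.
  annihilatorQuotient : (R : CommutativeRing 0ℓ 0ℓ) → CommutativeRing.Carrier R → CommutativeRing 0ℓ 0ℓ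
  annihilatorQuotient R a = record
    { Carrier = Carrier
    ; _≈_ = λ x y → a * x ≈ a * y
    ; _+_ = _+_ ; _*_ = _*_ ; -_ = -_ ; 0# = 0# ; 1# = 1#
    ; isCommutativeRing = record
      { isRing = record
        { +-isAbelianGroup = record
          { isGroup = record
            { isMonoid = record
              { isSemigroup = record
                { isMagma = record
                  { isEquivalence = record { refl = refl ; sym = sym ; trans = trans }
                  ; ∙-cong = λ {x} {y} {u} {v} p q →
                      trans (distribˡ a x u) (trans (+-cong p q) (sym (distribˡ a y v)))
                  }
                ; assoc = λ x y z → *-congˡ (+-assoc x y z)
                }
              ; identity = (λ x → *-congˡ (+-identityˡ x)) , (λ x → *-congˡ (+-identityʳ x))
              }
            ; inverse = (λ x → *-congˡ (-‿inverseˡ x)) , (λ x → *-congˡ (-‿inverseʳ x))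
            ; ⁻¹-cong = λ {x} {y} p →
                trans (sym (-‿distribʳ-* a x)) (trans (-‿cong p) (-‿distribʳ-* a y))
            }
          ; comm = λ x y → *-congˡ (+-comm x y)
          }
        ; *-cong = λ {x} {y} {u} {v} p q →
            trans (sym (*-assoc a x u)) (trans (*-congʳ p) (trans (*-congʳ (*-comm a y))
            (trans (*-assoc y a u) (trans (*-congˡ q)
            (trans (sym (*-assoc y a v)) (trans (*-congʳ (*-comm y a)) (*-assoc a y v)))))))
        ; *-assoc = λ x y z → *-congˡ (*-assoc x y z)
        ; *-identity = (λ x → *-congˡ (*-identityˡ x)) , (λ x → *-congˡ (*-identityʳ x))
        ; distrib = (λ x y z → *-congˡ (distribˡ x y z)) , (λ x y z → *-congˡ (distribʳ x y z))
        }
      ; *-comm = λ x y → *-congˡ (*-comm x y)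
      }
    }
    where
    open CommutativeRing R hiding (zero)
    open import Algebra.Properties.Ring ring using (-‿distribʳ-*)

  module ShortOrbits (R : CommutativeRing 0ℓ 0ℓ) where
    open CommutativeRing R hiding (zero)
    open import Algebra.Properties.Semiring.Exp semiring

    -- In a field, a nonzero x makes this vanish exactly when x ^ (p ^ j) ≈ x for some 1 ≤ j ≤ i.
    shortOrbits : ℕ → Carrier → ℕ → Carrier
    shortOrbits p x zero    = 1#
    shortOrbits p x (suc i) = (x ^ ℕ.pred (p ℕ.^ suc i) + - 1#) * shortOrbits p x i

-- The group ring of a cyclic group over ℤ/p.

module GroupRing where

  open Frobenius
  open import Algebra.Bundles using (CommutativeRing; AbelianGroup)
  open import Algebra.Definitions using (Associative; Commutative; LeftIdentity; LeftInverse)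
  open import Algebra.Consequences.Propositional using (comm∧idˡ⇒id; comm∧invˡ⇒inv)
  open import Data.Nat using (ℕ; zero; suc; _≤_; _<_; s≤s; s<s; NonZero)
  import Data.Nat as ℕ
  import Data.Nat.Properties as ℕ
  open import Data.Nat.DivMod using (_mod_; _%_; m%n<n; m<n⇒m%n≡m; %-distribˡ-+; n%n≡0)
  open import Data.Fin using (Fin; zero; suc; toℕ)
  open import Data.Fin.Properties using (toℕ-fromℕ<; toℕ-injective; toℕ<n) renaming (_≟_ to _≟F_)
  open import Data.List using (List; []; _∷_; _++_; length; [_]; cartesianProductWith; allFin) renaming (replicate to replicateL)
  import Data.List.Properties as List
  open import Data.List.Membership.Propositional using (_∈_)
  open import Data.List.Membership.Propositional.Properties using (∈-cartesianProductWith⁺; ∈-allFin)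
  open import Data.List.Relation.Unary.All using ([]; _∷_)
  open import Data.List.Relation.Unary.Any using (here)
  open import Data.Vec using (Vec; []; _∷_; zipWith; replicate; map; toList)
  open import Data.Vec.Properties using (zipWith-assoc; zipWith-comm; zipWith-identityˡ; zipWith-inverseˡ; length-toList; ≡-dec; ∷-injectiveˡ; ∷-injectiveʳ)
  open import Data.Product using (_,_; ∃; _×_)
  open import Relation.Nullary using (Dec; contradiction)
  open import Relation.Binary.PropositionalEquality using (_≡_; _≢_; refl; sym; trans; cong; cong₂; subst; subst₂; isEquivalence; module ≡-Reasoning)
  open import Level using (0ℓ)

  allVecs : ∀ k n → List (Vec (Fin k) n)
  allVecs k zero    = [ [] ]
  allVecs k (suc n) = cartesianProductWith _∷_ (allFin k) (allVecs k n)

  ∈-allVecs : ∀ {k n} (v : Vec (Fin k) n) → v ∈ allVecs k n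
  ∈-allVecs []      = here refl
  ∈-allVecs (a ∷ v) = ∈-cartesianProductWith⁺ _∷_ (∈-allFin a) (∈-allVecs v)

  module ModularAddition (p : ℕ) .{{_ : NonZero p}} where

    reduce : ℕ → Fin p
    reduce k = k mod p

    toℕ-reduce : ∀ k → toℕ (reduce k) ≡ k % p
    toℕ-reduce k = toℕ-fromℕ< (m%n<n k p)

    reduce-cong : ∀ {k l} → k % p ≡ l % p → reduce k ≡ reduce l
    reduce-cong {k} {l} e = toℕ-injective (trans (toℕ-reduce k) (trans e (sym (toℕ-reduce l))))

    reduce-toℕ : ∀ a → reduce (toℕ a) ≡ a
    reduce-toℕ a = toℕ-injective (trans (toℕ-reduce (toℕ a)) (m<n⇒m%n≡m (toℕ<n a)))

    infixl 6 _⊕_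
    _⊕_ : Fin p → Fin p → Fin p
    a ⊕ b = reduce (toℕ a ℕ.+ toℕ b)

    ⊖_ : Fin p → Fin p
    ⊖ a = reduce (p ℕ.∸ toℕ a)

    reduce-+ : ∀ k l → reduce (k ℕ.+ l) ≡ reduce k ⊕ reduce l
    reduce-+ k l = reduce-cong (trans (%-distribˡ-+ k l p)
      (cong₂ (λ a b → (a ℕ.+ b) % p) (sym (toℕ-reduce k)) (sym (toℕ-reduce l))))

    ⊕-assoc : Associative _≡_ _⊕_
    ⊕-assoc a b c = begin
      reduce (A ℕ.+ B) ⊕ c           ≡⟨ cong (reduce (A ℕ.+ B) ⊕_) (reduce-toℕ c) ⟨
      reduce (A ℕ.+ B) ⊕ reduce C    ≡⟨ reduce-+ (A ℕ.+ B) C ⟨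
      reduce (A ℕ.+ B ℕ.+ C)         ≡⟨ cong reduce (ℕ.+-assoc A B C) ⟩
      reduce (A ℕ.+ (B ℕ.+ C))       ≡⟨ reduce-+ A (B ℕ.+ C) ⟩
      reduce A ⊕ reduce (B ℕ.+ C)    ≡⟨ cong (_⊕ reduce (B ℕ.+ C)) (reduce-toℕ a) ⟩
      a ⊕ (b ⊕ c)                    ∎
      where
      open ≡-Reasoning
      A = toℕ a
      B = toℕ b
      C = toℕ c

    ⊕-comm : Commutative _≡_ _⊕_
    ⊕-comm a b = cong reduce (ℕ.+-comm (toℕ a) (toℕ b))

    ⊕-identityˡ : LeftIdentity _≡_ (reduce 0) _⊕_
    ⊕-identityˡ a = begin
      reduce 0 ⊕ a               ≡⟨ cong (reduce 0 ⊕_) (reduce-toℕ a) ⟨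
      reduce 0 ⊕ reduce (toℕ a)  ≡⟨ reduce-+ 0 (toℕ a) ⟨
      reduce (toℕ a)             ≡⟨ reduce-toℕ a ⟩
      a                          ∎
      where open ≡-Reasoning

    reduce-p : reduce p ≡ reduce 0
    reduce-p = reduce-cong (trans (n%n≡0 p) (sym (m<n⇒m%n≡m (ℕ.>-nonZero⁻¹ p))))

    ⊕-inverseˡ : LeftInverse _≡_ (reduce 0) ⊖_ _⊕_
    ⊕-inverseˡ a = begin
      ⊖ a ⊕ a                       ≡⟨ cong (⊖ a ⊕_) (reduce-toℕ a) ⟨
      ⊖ a ⊕ reduce (toℕ a)          ≡⟨ reduce-+ (p ℕ.∸ toℕ a) (toℕ a) ⟨
      reduce (p ℕ.∸ toℕ a ℕ.+ toℕ a) ≡⟨ cong reduce (ℕ.m∸n+n≡m (ℕ.<⇒≤ (toℕ<n a))) ⟩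
      reduce p                      ≡⟨ reduce-p ⟩
      reduce 0                      ∎
      where open ≡-Reasoning

    vectors : ℕ → AbelianGroup 0ℓ 0ℓ
    vectors n = record
      { Carrier = Vec (Fin p) n
      ; _≈_ = _≡_
      ; _∙_ = zipWith _⊕_
      ; ε = replicate n (reduce 0)
      ; _⁻¹ = map ⊖_
      ; isAbelianGroup = record
        { isGroup = record
          { isMonoid = record
            { isSemigroup = record
              { isMagma = record { isEquivalence = isEquivalence ; ∙-cong = cong₂ (zipWith _⊕_) }
              ; assoc = zipWith-assoc ⊕-assoc }
            ; identity = comm∧idˡ⇒id (zipWith-comm ⊕-comm) (zipWith-identityˡ ⊕-identityˡ) }
          ; inverse = comm∧invˡ⇒inv (zipWith-comm ⊕-comm) (zipWith-inverseˡ ⊕-inverseˡ)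
          ; ⁻¹-cong = cong (map ⊖_) }
        ; comm = zipWith-comm ⊕-comm }
      }

  module OperatorPolynomials
    (G : AbelianGroup 0ℓ 0ℓ) (X : AbelianGroup.Carrier G → AbelianGroup.Carrier G)
    (X-cong : ∀ {v w} → AbelianGroup._≈_ G v w → AbelianGroup._≈_ G (X v) (X w))
    (X-+ : ∀ v w → AbelianGroup._≈_ G (X (AbelianGroup._∙_ G v w)) (AbelianGroup._∙_ G (X v) (X w)))
    where

    open AbelianGroup G renaming
      ( _∙_ to infixl 6 _+_; ε to 0#; ∙-cong to +-cong; identityˡ to +-identityˡ
      ; refl to ≈-refl; sym to ≈-sym; trans to ≈-trans)
    open import Algebra.Properties.CommutativeMonoid.Mult commutativeMonoid renaming (_×_ to _·_)
    open import Algebra.Properties.CommutativeSemigroup commutativeSemigroup using (interchange)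
    open import Algebra.Properties.Group group using (identityʳ-unique)
    open import Relation.Binary.Reasoning.Setoid setoid

    additive-0 : (f : Carrier → Carrier) → (∀ {v w} → v ≈ w → f v ≈ f w) →
                 (∀ v w → f (v + w) ≈ f v + f w) → f 0# ≈ 0#
    additive-0 f f-cong f-+ = identityʳ-unique (f 0#) (f 0#)
      (≈-trans (≈-sym (f-+ 0# 0#)) (f-cong (+-identityˡ 0#)))

    additive-· : (f : Carrier → Carrier) → (∀ {v w} → v ≈ w → f v ≈ f w) →
                 (∀ v w → f (v + w) ≈ f v + f w) → ∀ k v → f (k · v) ≈ k · f v
    additive-· f f-cong f-+ zero    v = additive-0 f f-cong f-+
    additive-· f f-cong f-+ (suc k) v =
      ≈-trans (f-+ v (k · v)) (+-cong ≈-refl (additive-· f f-cong f-+ k v))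

    -- Horner's scheme for the polynomial c₀ + c₁X + c₂X² + ... in the operator X. With natural
    -- numbers as coefficients, repeated addition in `G` is the only scalar action needed.
    apply : List ℕ → Carrier → Carrier
    apply []      v = 0#
    apply (c ∷ u) v = c · v + X (apply u v)

    apply-cong : ∀ u {v w} → v ≈ w → apply u v ≈ apply u w
    apply-cong []      v≈w = ≈-refl
    apply-cong (c ∷ u) v≈w = +-cong (×-congʳ c v≈w) (X-cong (apply-cong u v≈w))

    apply-+ : ∀ u v w → apply u (v + w) ≈ apply u v + apply u w
    apply-+ []      v w = ≈-sym (+-identityˡ 0#)
    apply-+ (c ∷ u) v w = begin
      c · (v + w) + X (apply u (v + w))
        ≈⟨ +-cong (×-distrib-+ v w c) (≈-trans (X-cong (apply-+ u v w)) (X-+ _ _)) ⟩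
      (c · v + c · w) + (X (apply u v) + X (apply u w))
        ≈⟨ interchange _ _ _ _ ⟩
      apply (c ∷ u) v + apply (c ∷ u) w ∎

    apply-X : ∀ u v → apply u (X v) ≈ X (apply u v)
    apply-X []      v = ≈-sym (additive-0 X X-cong X-+)
    apply-X (c ∷ u) v = begin
      c · X v + X (apply u (X v))
        ≈⟨ +-cong (≈-sym (additive-· X X-cong X-+ c v)) (X-cong (apply-X u v)) ⟩
      X (c · v) + X (X (apply u v))  ≈⟨ X-+ _ _ ⟨
      X (c · v + X (apply u v))      ∎

    -- Each `apply w` is additive and commutes with X, hence with every polynomial in X.
    -- Commutativity and associativity of the product below both come from this.
    apply-comm : ∀ u w v → apply u (apply w v) ≈ apply w (apply u v)
    apply-comm []      w v = ≈-sym (additive-0 (apply w) (apply-cong w) (apply-+ w))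
    apply-comm (c ∷ u) w v = begin
      c · apply w v + X (apply u (apply w v))
        ≈⟨ +-cong (≈-sym (additive-· (apply w) (apply-cong w) (apply-+ w) c v))
                  (≈-trans (X-cong (apply-comm u w v)) (≈-sym (apply-X w _))) ⟩
      apply w (c · v) + apply w (X (apply u v))  ≈⟨ apply-+ w _ _ ⟨
      apply w (c · v + X (apply u v))            ∎

    -- A group on which the polynomials in X act with a cyclic vector e is a
    -- commutative ring: v is identified with a polynomial taking e to v.
    module CyclicVector (coefficients : Carrier → List ℕ)
      (coefficients-cong : ∀ {u v} → u ≈ v → ∀ w → apply (coefficients u) w ≈ apply (coefficients v) w)
      (e : Carrier) (cyclic : ∀ v → apply (coefficients v) e ≈ v) where

      infixl 7 _*_
      _*_ : Carrier → Carrier → Carrier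
      u * v = apply (coefficients u) v

      *-comm : ∀ u v → u * v ≈ v * u
      *-comm u v = begin
        u * v        ≈⟨ apply-cong (coefficients u) (cyclic v) ⟨
        u * (v * e)  ≈⟨ apply-comm (coefficients u) (coefficients v) e ⟩
        v * (u * e)  ≈⟨ apply-cong (coefficients v) (cyclic u) ⟩
        v * u        ∎

      *-cong : ∀ {u v w z} → u ≈ v → w ≈ z → u * w ≈ v * z
      *-cong {u} {v} u≈v w≈z = ≈-trans (coefficients-cong u≈v _) (apply-cong (coefficients v) w≈z)

      *-assoc : ∀ u v w → (u * v) * w ≈ u * (v * w)
      *-assoc u v w = begin
        (u * v) * w  ≈⟨ *-comm (u * v) w ⟩
        w * (u * v)  ≈⟨ apply-comm (coefficients w) (coefficients u) v ⟩
        u * (w * v)  ≈⟨ apply-cong (coefficients u) (*-comm w v) ⟩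
        u * (v * w)  ∎

      distribˡ : ∀ u v w → u * (v + w) ≈ u * v + u * w
      distribˡ u = apply-+ (coefficients u)

      distribʳ : ∀ u v w → (v + w) * u ≈ v * u + w * u
      distribʳ u v w = ≈-trans (*-comm (v + w) u)
        (≈-trans (distribˡ u v w) (+-cong (*-comm u v) (*-comm u w)))

      cyclicRing : CommutativeRing 0ℓ 0ℓ
      cyclicRing = record
        { _+_ = _+_ ; _*_ = _*_ ; 0# = 0# ; 1# = e
        ; isCommutativeRing = record
          { isRing = record
            { +-isAbelianGroup = isAbelianGroup
            ; *-cong = *-cong
            ; *-assoc = *-assoc
            ; *-identity = (λ v → ≈-trans (*-comm e v) (cyclic v)) , cyclic
            ; distrib = distribˡ , distribʳ
            }
          ; *-comm = *-comm
          }
        }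

      X≈*x : ∀ v → X v ≈ X e * v
      X≈*x v = begin
        X v        ≈⟨ X-cong (cyclic v) ⟨
        X (v * e)  ≈⟨ apply-X (coefficients v) e ⟨
        v * X e    ≈⟨ *-comm v (X e) ⟩
        X e * v    ∎

      -- Horner's scheme read as an induction principle: every element arises from 0 by multiplying
      -- with `X e` and adding a multiple of the unit. It replaces any reference to coefficients
      -- once the ring is built.
      generated : (P : Carrier → Set) → (∀ {v w} → v ≈ w → P v → P w) → P 0# →
                  (∀ c w → P w → P (c · e + X e * w)) → ∀ v → P v
      generated P resp P0 P+ v = resp (cyclic v) (go (coefficients v))
        where
        go : ∀ u → P (apply u e)
        go []      = P0
        go (c ∷ u) = resp (+-cong ≈-refl (≈-sym (X≈*x _))) (P+ c _ (go u))

  -- (ℤ/p)[ξ] / (ξ ^ n − 1) on coefficient vectors, from the constant term up; ξ acts by rotation.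
  module CyclicGroupRing (p : ℕ) .{{_ : NonZero p}} (m : ℕ) where
    open ModularAddition p

    n : ℕ
    n = suc m

    private
      𝟘 : Fin p
      𝟘 = reduce 0

    open AbelianGroup (vectors n) public
      using (commutativeMonoid)
      renaming (Carrier to V; _∙_ to infixl 6 _+_; ε to 0#; _⁻¹ to infix 8 -_)
    open import Algebra.Properties.CommutativeMonoid.Mult commutativeMonoid renaming (_×_ to _·_)

    lastOr : ∀ {k} → Fin p → Vec (Fin p) k → Fin p
    lastOr a []      = a
    lastOr a (b ∷ v) = lastOr b v

    shiftIn : ∀ {k} → Fin p → Vec (Fin p) k → Vec (Fin p) k
    shiftIn a []      = []
    shiftIn a (b ∷ v) = a ∷ shiftIn b v

    rotate : V → V
    rotate (a ∷ v) = lastOr a v ∷ shiftIn a v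

    lastOr-+ : ∀ {k} a b (v w : Vec (Fin p) k) →
               lastOr (a ⊕ b) (zipWith _⊕_ v w) ≡ lastOr a v ⊕ lastOr b w
    lastOr-+ a b []      []      = refl
    lastOr-+ a b (c ∷ v) (d ∷ w) = lastOr-+ c d v w

    shiftIn-+ : ∀ {k} a b (v w : Vec (Fin p) k) →
                shiftIn (a ⊕ b) (zipWith _⊕_ v w) ≡ zipWith _⊕_ (shiftIn a v) (shiftIn b w)
    shiftIn-+ a b []      []      = refl
    shiftIn-+ a b (c ∷ v) (d ∷ w) = cong (a ⊕ b ∷_) (shiftIn-+ c d v w)

    rotate-+ : ∀ v w → rotate (v + w) ≡ rotate v + rotate w
    rotate-+ (a ∷ v) (b ∷ w) = cong₂ _∷_ (lastOr-+ a b v w) (shiftIn-+ a b v w)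

    -- Polynomials as lists of varying length, so that degrees can be tracked, are brought to `k`
    -- coefficients by adding zeros or by cutting off the high ones.
    pad : ∀ k → List (Fin p) → Vec (Fin p) k
    pad zero    u       = []
    pad (suc k) []      = 𝟘 ∷ pad k []
    pad (suc k) (a ∷ u) = a ∷ pad k u

    length-zeros-++ : ∀ k u → length (replicateL k 𝟘 ++ u) ≡ k ℕ.+ length u
    length-zeros-++ k u = trans (List.length-++ (replicateL k 𝟘)) (cong (ℕ._+ length u) (List.length-replicate k))

    length-∷ʳ : ∀ (u : List (Fin p)) a → length (u ++ [ a ]) ≡ suc (length u)
    length-∷ʳ u a = trans (List.length-++ u) (ℕ.+-comm (length u) 1)

    pad-[] : ∀ k → pad k [] ≡ replicate k 𝟘
    pad-[] zero    = refl
    pad-[] (suc k) = cong (𝟘 ∷_) (pad-[] k)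

    pad-[0] : ∀ k → pad k (𝟘 ∷ []) ≡ pad k []
    pad-[0] zero    = refl
    pad-[0] (suc k) = refl

    pad-toList : ∀ {k} (v : Vec (Fin p) k) → pad k (toList v) ≡ v
    pad-toList []      = refl
    pad-toList (a ∷ v) = cong (a ∷_) (pad-toList v)

    shiftIn-pad : ∀ k a u → shiftIn a (pad k u) ≡ pad k (a ∷ u)
    shiftIn-pad zero    a u       = refl
    shiftIn-pad (suc k) a []      = cong (a ∷_) (trans (shiftIn-pad k 𝟘 []) (pad-[0] k))
    shiftIn-pad (suc k) a (b ∷ u) = cong (a ∷_) (shiftIn-pad k b u)

    lastOr-pad-[] : ∀ k → lastOr 𝟘 (pad k []) ≡ 𝟘
    lastOr-pad-[] zero    = refl
    lastOr-pad-[] (suc k) = lastOr-pad-[] k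

    lastOr-pad : ∀ k a u → length u < k → lastOr a (pad k u) ≡ 𝟘
    lastOr-pad (suc k) a []      u<k       = lastOr-pad-[] k
    lastOr-pad (suc k) a (b ∷ u) (s<s u<k) = lastOr-pad k b u u<k

    -- Below degree n there is no wrap-around: the entry that returns to the front is a padding
    -- zero, so rotation is plain multiplication by ξ.
    rotate-pad : ∀ u → length u < n → rotate (pad n u) ≡ pad n (𝟘 ∷ u)
    rotate-pad []      _         = cong₂ _∷_ (lastOr-pad-[] m) (trans (shiftIn-pad m 𝟘 []) (pad-[0] m))
    rotate-pad (a ∷ u) (s<s u<m) = cong₂ _∷_ (lastOr-pad m a u u<m) (shiftIn-pad m a u)

    𝟙 : V
    𝟙 = pad n (reduce 1 ∷ [])

    ·-∷ : ∀ k → k · 𝟙 ≡ pad n (reduce k ∷ [])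
    ·-∷ zero    = cong (𝟘 ∷_) (sym (pad-[] m))
    ·-∷ (suc k) rewrite ·-∷ k = cong₂ _∷_ (sym (reduce-+ 1 k))
      (trans (cong (λ w → zipWith _⊕_ w (pad m [])) (pad-[] m)) (zipWith-identityˡ ⊕-identityˡ (pad m [])))

    open OperatorPolynomials (vectors n) rotate (cong rotate) rotate-+ using (apply; module CyclicVector)

    -- This makes 𝟙 a cyclic vector: a polynomial of degree below n, applied to 𝟙, reproduces its
    -- own coefficients.
    apply-𝟙 : ∀ u → length u ≤ n → apply (Data.List.map toℕ u) 𝟙 ≡ pad n u
    apply-𝟙 []      _   = sym (pad-[] n)
    apply-𝟙 (a ∷ u) u<n
      rewrite apply-𝟙 u (ℕ.<⇒≤ u<n) | rotate-pad u u<n | ·-∷ (toℕ a) =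
      cong₂ _∷_ (begin
        reduce (toℕ a) ⊕ 𝟘  ≡⟨ ⊕-comm _ 𝟘 ⟩
        𝟘 ⊕ reduce (toℕ a)  ≡⟨ ⊕-identityˡ _ ⟩
        reduce (toℕ a)      ≡⟨ reduce-toℕ a ⟩
        a                   ∎)
        (trans (cong (λ w → zipWith _⊕_ w (pad m u)) (pad-[] m)) (zipWith-identityˡ ⊕-identityˡ (pad m u)))
      where open ≡-Reasoning

    coefficients : V → List ℕ
    coefficients v = Data.List.map toℕ (toList v)

    open CyclicVector coefficients (λ u≡v w → cong (λ z → apply (coefficients z) w) u≡v) 𝟙
      (λ v → trans (apply-𝟙 (toList v) (ℕ.≤-reflexive (length-toList v))) (pad-toList v))
      public

    open CommutativeRing cyclicRing public using (1#; semiring; ring; *-identityʳ; *-identityˡ)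
    open import Algebra.Properties.Semiring.Exp semiring public using (_^_)
    open import Algebra.Properties.Ring ring using (-1*x≈-x)

    ξ : V
    ξ = rotate 𝟙

    characteristic : p · 1# ≡ 0#
    characteristic = trans (·-∷ p) (cong₂ _∷_ reduce-p (pad-[] m))

    ξ^*pad : ∀ k u → k ℕ.+ length u ≤ n → ξ ^ k * pad n u ≡ pad n (replicateL k 𝟘 ++ u)
    ξ^*pad zero    u _     = *-identityˡ (pad n u)
    ξ^*pad (suc k) u k+u<n = begin
      ξ * ξ ^ k * pad n u                  ≡⟨ *-assoc ξ (ξ ^ k) (pad n u) ⟩
      ξ * (ξ ^ k * pad n u)                ≡⟨ cong (ξ *_) (ξ^*pad k u (ℕ.<⇒≤ k+u<n)) ⟩
      ξ * pad n (replicateL k 𝟘 ++ u)      ≡⟨ X≈*x _ ⟨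
      rotate (pad n (replicateL k 𝟘 ++ u)) ≡⟨ rotate-pad _ (subst (_< n) (sym (length-zeros-++ k u)) k+u<n) ⟩
      pad n (𝟘 ∷ replicateL k 𝟘 ++ u)      ∎
      where open ≡-Reasoning

    pad-zeros : ∀ k u → pad k (replicateL k 𝟘 ++ u) ≡ pad k []
    pad-zeros zero    u = refl
    pad-zeros (suc k) u = cong (𝟘 ∷_) (pad-zeros k u)

    lastOr-pad-zeros : ∀ k a b → lastOr a (pad (suc k) (replicateL k 𝟘 ++ [ b ])) ≡ b
    lastOr-pad-zeros zero    a b = refl
    lastOr-pad-zeros (suc k) a b = lastOr-pad-zeros k 𝟘 b

    -- The one place where wrap-around happens: the top coefficient is cut off by the shift and
    -- reappears as the constant term. The copy `k` of the module parameter `m`, tied to it by an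
    -- equation, can be split by pattern matching.
    rotate-last : ∀ k u → k ≡ m → u ≡ replicateL k 𝟘 ++ [ reduce 1 ] → rotate (pad n u) ≡ 𝟙
    rotate-last zero    u refl refl = refl
    rotate-last (suc k) u refl refl = cong₂ _∷_ (lastOr-pad-zeros k 𝟘 (reduce 1))
      (trans (shiftIn-pad m 𝟘 (replicateL k 𝟘 ++ [ reduce 1 ])) (pad-zeros m _))

    ξ^n≡1 : ξ ^ n ≡ 1#
    ξ^n≡1 = begin
      ξ * ξ ^ m                                    ≡⟨ X≈*x _ ⟨
      rotate (ξ ^ m)                               ≡⟨ cong rotate (*-identityʳ (ξ ^ m)) ⟨
      rotate (ξ ^ m * 𝟙)                           ≡⟨ cong rotate (ξ^*pad m [ reduce 1 ] (ℕ.≤-reflexive (ℕ.+-comm m 1))) ⟩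
      rotate (pad n (replicateL m 𝟘 ++ [ reduce 1 ]))  ≡⟨ rotate-last m _ refl refl ⟩
      𝟙                                            ∎
      where open ≡-Reasoning

    -- The list holds the coefficients below the leading 1. The degree is meaningful only for `d`
    -- below `n`, as otherwise `pad n` cuts off the leading coefficient.
    Monic : ℕ → V → Set
    Monic d v = ∃ λ u → length u ≡ d × v ≡ pad n (u ++ [ reduce 1 ])

    monic-1 : Monic 0 1#
    monic-1 = [] , refl , refl

    -- `b` is shorter than `a` with its leading 1, so the subtraction does not reach that 1. The
    -- list `u` is chosen before `k`, which lets the induction go through under every truncation.
    pad-∸ : ∀ a b → length b ≤ length a → ∃ λ u → length u ≡ length a ×
            (∀ k → zipWith _⊕_ (pad k (a ++ [ reduce 1 ])) (map ⊖_ (pad k b)) ≡ pad k (u ++ [ reduce 1 ]))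
    pad-∸ a [] _ = a , refl , λ k → trans
      (cong (zipWith _⊕_ _) (trans (cong (map ⊖_) (pad-[] k)) (⁻¹-ε k)))
      (AbelianGroup.identityʳ (vectors k) _)
      where
      ⁻¹-ε : ∀ k → map ⊖_ (replicate k 𝟘) ≡ replicate k 𝟘
      ⁻¹-ε k = ε⁻¹≈ε where open import Algebra.Properties.Group (AbelianGroup.group (vectors k)) using (ε⁻¹≈ε)
    pad-∸ (c ∷ a) (d ∷ b) (s≤s b≤a) with u , u-length , u-pad ← pad-∸ a b b≤a =
      c ⊕ ⊖ d ∷ u , cong suc u-length ,
      λ { zero → refl ; (suc k) → cong (c ⊕ ⊖ d ∷_) (u-pad k) }

    -- The product is ξ^(k + 1) v - v. The first term is an honest shift because its degree stays
    -- below n, and since the shift is by at least one place, subtracting v leaves the leading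
    -- coefficient intact.
    monic-step : ∀ {k d v} → suc k ℕ.+ d < n → Monic d v → Monic (suc k ℕ.+ d) ((ξ ^ suc k + - 1#) * v)
    monic-step {k} {d} {v} k+d<n (u , refl , refl)
      with w , w-length , w-pad ← pad-∸ (replicateL (suc k) 𝟘 ++ u) (u ++ [ reduce 1 ])
             (subst₂ _≤_ (sym (length-∷ʳ u _)) (sym (length-zeros-++ (suc k) u)) (s≤s (ℕ.m≤n+m (length u) k)))
      = w , trans w-length (length-zeros-++ (suc k) u) , (begin
        (ξ ^ suc k + - 1#) * v       ≡⟨ distribʳ v (ξ ^ suc k) (- 1#) ⟩
        ξ ^ suc k * v + - 1# * v     ≡⟨ cong₂ _+_ (ξ^*pad (suc k) (u ++ [ reduce 1 ]) k+d≤n) (-1*x≈-x v) ⟩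
        pad n (replicateL (suc k) 𝟘 ++ u ++ [ reduce 1 ]) + - v
          ≡⟨ cong (λ z → pad n z + - v) (List.++-assoc (replicateL (suc k) 𝟘) u _) ⟨
        pad n ((replicateL (suc k) 𝟘 ++ u) ++ [ reduce 1 ]) + - v  ≡⟨ w-pad n ⟩
        pad n (w ++ [ reduce 1 ])    ∎)
      where
      open ≡-Reasoning
      k+d≤n : suc k ℕ.+ length (u ++ [ reduce 1 ]) ≤ n
      k+d≤n = subst (_≤ n) (sym (trans (cong (suc k ℕ.+_) (length-∷ʳ u _)) (ℕ.+-suc (suc k) (length u)))) k+d<n

    pad-≢0 : reduce 1 ≢ 𝟘 → ∀ k u → length u < k → pad k (u ++ [ reduce 1 ]) ≢ replicate k 𝟘
    pad-≢0 1≢0 (suc k) []      _         eq = 1≢0 (∷-injectiveˡ eq)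
    pad-≢0 1≢0 (suc k) (a ∷ u) (s<s u<k) eq = pad-≢0 1≢0 k u u<k (∷-injectiveʳ eq)

    open ShortOrbits cyclicRing using (shortOrbits)

    degree : ℕ → ℕ
    degree zero    = 0
    degree (suc i) = ℕ.pred (p ℕ.^ suc i) ℕ.+ degree i

    module _ (2≤p : 2 ≤ p) where

      2≤p^ : ∀ i → 2 ≤ p ℕ.^ suc i
      2≤p^ i = ℕ.≤-trans 2≤p (ℕ.m≤m*n p (p ℕ.^ i) {{ℕ.m^n≢0 p i}})

      -- The sum of p^j - 1 over 1 ≤ j ≤ i is dominated by the next power of p, because p ≥ 2 makes
      -- each power at least double the one before. The summand 2 is what is needed to conclude
      -- `degree i < n` from `p ^ suc i ≤ suc n`.
      degree-bound : ∀ i → 2 ℕ.+ degree i ≤ p ℕ.^ suc i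
      degree-bound zero    = 2≤p^ 0
      degree-bound (suc i) = begin
        2 ℕ.+ (ℕ.pred P ℕ.+ degree i)  ≡⟨ ℕ.+-suc (suc (ℕ.pred P)) (degree i) ⟨
        suc (ℕ.pred P) ℕ.+ suc (degree i) ≡⟨ cong (ℕ._+ suc (degree i)) (ℕ.suc-pred P {{ℕ.m^n≢0 p (suc i)}}) ⟩
        P ℕ.+ suc (degree i)    ≤⟨ ℕ.+-monoʳ-≤ P (ℕ.≤-trans (ℕ.n≤1+n _) (degree-bound i)) ⟩
        P ℕ.+ P                 ≡⟨ cong (P ℕ.+_) (ℕ.+-identityʳ P) ⟨
        2 ℕ.* P                 ≤⟨ ℕ.*-monoˡ-≤ P 2≤p ⟩
        p ℕ.* P                 ∎
        where
        open ℕ.≤-Reasoning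
        P = p ℕ.^ suc i

      monic-shortOrbits : ∀ i → p ℕ.^ suc i ≤ suc n → Monic (degree i) (shortOrbits p ξ i)
      monic-shortOrbits zero    _    = monic-1
      -- The predecessor must be exposed as some `suc k` for `monic-step`; it is positive because
      -- the power is at least 2.
      monic-shortOrbits (suc i) P≤q with ℕ.pred (p ℕ.^ suc i) in eq
      ... | zero  = contradiction (subst (1 ≤_) eq (ℕ.pred-mono-≤ (2≤p^ i))) λ ()
      ... | suc k = monic-step
        (ℕ.≤-pred (ℕ.≤-trans (subst (λ z → 2 ℕ.+ (z ℕ.+ degree i) ≤ p ℕ.^ suc (suc i)) eq (degree-bound (suc i))) P≤q))
        (monic-shortOrbits i (ℕ.≤-trans (ℕ.^-monoʳ-≤ p (ℕ.n≤1+n (suc i))) P≤q))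

      shortOrbits-≢0 : ∀ i → p ℕ.^ suc i ≤ suc n → shortOrbits p ξ i ≢ 0#
      shortOrbits-≢0 i P≤q eq with u , u-length , u-pad ← monic-shortOrbits i P≤q =
        pad-≢0 1≢0 n u (subst (_< n) (sym u-length) (ℕ.≤-pred (ℕ.≤-trans (degree-bound i) P≤q))) (trans (sym u-pad) eq)
        where
        1≢0 : reduce 1 ≢ 𝟘
        1≢0 e with () ← trans (sym (m<n⇒m%n≡m 2≤p))
                    (trans (sym (toℕ-reduce 1)) (trans (cong toℕ e) (trans (toℕ-reduce 0) (m<n⇒m%n≡m (ℕ.<⇒≤ 2≤p)))))

    _≟V_ : (v w : V) → Dec (v ≡ w)
    _≟V_ = ≡-dec _≟F_

-- Roots of polynomials, products of units, and primitive idempotents.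

module Fields where

  open Frobenius
  open import Algebra.Bundles using (CommutativeRing)
  open import Data.Nat using (ℕ; zero; suc; _≤_; z≤n; s≤s)
  import Data.Nat as ℕ
  import Data.Nat.Properties as ℕ
  open import Data.Fin using (Fin; zero; suc; punchIn)
  open import Data.Fin.Properties using (punchInᵢ≢i; suc-injective)
  open import Data.Fin.Permutation using (permutation; Permutation′)
  open import Data.List using (List; []; _∷_; length; replicate)
  import Data.List.Properties as List
  open import Data.List.Relation.Unary.All using (All; []; _∷_)
  open import Data.Product using (_,_; ∃; _×_)
  open import Data.Sum using (_⊎_; inj₁; inj₂)
  open import Function using (_∘_)
  open import Relation.Nullary using (¬_; Dec; yes; no; contradiction)
  open import Relation.Binary.PropositionalEquality as ≡ using (_≡_)
  open import Level using (0ℓ)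

  record Field : Set₁ where
    field
      commutativeRing : CommutativeRing 0ℓ 0ℓ
    open CommutativeRing commutativeRing public
    field
      _≟_     : ∀ x y → Dec (x ≈ y)
      1≉0     : ¬ 1# ≈ 0#
      inverse : ∀ {x} → ¬ x ≈ 0# → ∃ λ y → x * y ≈ 1#

  record Enumeration (K : Field) (N : ℕ) : Set where
    open Field K using (Carrier; _≈_)
    field
      from    : Fin N → Carrier
      to      : Carrier → Fin N
      to-cong : ∀ {x y} → x ≈ y → to x ≡ to y
      to-from : ∀ i → to (from i) ≡ i
      from-to : ∀ x → from (to x) ≈ x

  module FieldProperties (K : Field) where
    open Field K hiding (zero)
    open import Algebra.Properties.Semiring.Exp semiring
    open import Algebra.Properties.Ring ring
    open import Algebra.Properties.CommutativeSemigroup (CommutativeRing.+-commutativeSemigroup commutativeRing)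
      using () renaming (x∙yz≈y∙xz to x+[y+z]≈y+[x+z])
    open import Algebra.Properties.CommutativeSemigroup (CommutativeRing.*-commutativeSemigroup commutativeRing)
      using () renaming (x∙yz≈y∙xz to x*[y*z]≈y*[x*z])
    open import Relation.Binary.Reasoning.Setoid setoid

    integral : ∀ {x y} → ¬ x ≈ 0# → x * y ≈ 0# → y ≈ 0#
    integral {x} {y} x≉0 xy≈0 with x⁻¹ , xx⁻¹≈1 ← inverse x≉0 = begin
      y               ≈⟨ *-identityˡ y ⟨
      1# * y          ≈⟨ *-congʳ (trans (*-comm x⁻¹ x) xx⁻¹≈1) ⟨
      (x⁻¹ * x) * y   ≈⟨ *-assoc x⁻¹ x y ⟩
      x⁻¹ * (x * y)   ≈⟨ *-congˡ xy≈0 ⟩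
      x⁻¹ * 0#        ≈⟨ zeroʳ x⁻¹ ⟩
      0#              ∎

    *-≉0 : ∀ {x y} → ¬ x ≈ 0# → ¬ y ≈ 0# → ¬ x * y ≈ 0#
    *-≉0 x≉0 y≉0 xy≈0 = y≉0 (integral x≉0 xy≈0)

    x≈[x-a]+a : ∀ x a → x ≈ (x - a) + a
    x≈[x-a]+a x a = sym (trans (+-assoc x (- a) a) (trans (+-congˡ (-‿inverseˡ a)) (+-identityʳ x)))

    x-y≈0⇒x≈y : ∀ {x y} → x - y ≈ 0# → x ≈ y
    x-y≈0⇒x≈y {x} {y} e = trans (x≈[x-a]+a x y) (trans (+-congʳ e) (+-identityˡ y))

    *-cancelˡ : ∀ {x y z} → ¬ x ≈ 0# → x * y ≈ x * z → y ≈ z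
    *-cancelˡ {x} {y} {z} x≉0 xy≈xz = x-y≈0⇒x≈y (integral x≉0 (begin
      x * (y - z)    ≈⟨ x[y-z]≈xy-xz x y z ⟩
      x * y - x * z  ≈⟨ +-congʳ xy≈xz ⟩
      x * z - x * z  ≈⟨ -‿inverseʳ _ ⟩
      0#             ∎))

    -- The monic polynomial whose non-leading coefficients are listed from the constant term up.
    monic : List Carrier → Carrier → Carrier
    monic []       x = 1#
    monic (c ∷ cs) x = c + x * monic cs x

    -- Synthetic division by x - a: the coefficients of the quotient are the values at `a` of the
    -- successive Horner tails, and its leading 1 is again implicit. The value on `[]` is a dummy,
    -- since the constant 1 has no monic quotient.
    divideBy : Carrier → List Carrier → List Carrier
    divideBy a []            = []
    divideBy a (c ∷ [])      = []
    divideBy a (c ∷ d ∷ cs)  = monic (d ∷ cs) a ∷ divideBy a (d ∷ cs)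

    length-divideBy : ∀ a c cs → length (divideBy a (c ∷ cs)) ≡ length cs
    length-divideBy a c []       = ≡.refl
    length-divideBy a c (d ∷ cs) = ≡.cong suc (length-divideBy a d cs)

    monic-divideBy : ∀ a c cs x →
      monic (c ∷ cs) x ≈ (x - a) * monic (divideBy a (c ∷ cs)) x + monic (c ∷ cs) a
    monic-divideBy a c []       x = begin
      c + x * 1#                      ≈⟨ +-congˡ (*-congʳ (x≈[x-a]+a x a)) ⟩
      c + ((x - a) + a) * 1#          ≈⟨ +-congˡ (distribʳ 1# (x - a) a) ⟩
      c + ((x - a) * 1# + a * 1#)     ≈⟨ x+[y+z]≈y+[x+z] _ _ _ ⟩
      (x - a) * 1# + (c + a * 1#)     ∎
    monic-divideBy a c (d ∷ cs) x = begin
      c + x * monic (d ∷ cs) x            ≈⟨ +-congˡ (*-congˡ (monic-divideBy a d cs x)) ⟩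
      c + x * ((x - a) * D + M)           ≈⟨ +-congˡ (distribˡ x _ _) ⟩
      c + (x * ((x - a) * D) + x * M)     ≈⟨ +-congˡ (+-cong (x*[y*z]≈y*[x*z] x (x - a) D) x*M) ⟩
      c + ((x - a) * (x * D) + ((x - a) * M + a * M))
                                          ≈⟨ +-congˡ (+-assoc _ _ _) ⟨
      c + (((x - a) * (x * D) + (x - a) * M) + a * M)
                                          ≈⟨ +-congˡ (+-congʳ (trans (+-comm _ _) (sym (distribˡ (x - a) M (x * D))))) ⟩
      c + ((x - a) * (M + x * D) + a * M) ≈⟨ x+[y+z]≈y+[x+z] _ _ _ ⟩
      (x - a) * (M + x * D) + (c + a * M) ∎
      where
      D = monic (divideBy a (d ∷ cs)) x
      M = monic (d ∷ cs) a
      x*M : x * M ≈ (x - a) * M + a * M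
      x*M = trans (*-congʳ (x≈[x-a]+a x a)) (distribʳ M (x - a) a)

    root-bound : ∀ {N} cs (f : Fin N → Carrier) → (∀ {i j} → f i ≈ f j → i ≡ j) →
                 (∀ i → monic cs (f i) ≈ 0#) → N ≤ length cs
    root-bound {zero}  cs       f f-inj roots = z≤n
    root-bound {suc N} []       f f-inj roots = contradiction (roots zero) 1≉0
    root-bound {suc N} (c ∷ cs) f f-inj roots =
      s≤s (≡.subst (N ≤_) (length-divideBy a c cs)
        (root-bound (divideBy a (c ∷ cs)) (f ∘ suc) (suc-injective ∘ f-inj) roots′))
      where
      a = f zero
      roots′ : ∀ i → monic (divideBy a (c ∷ cs)) (f (suc i)) ≈ 0#
      roots′ i = integral x-a≉0 (begin
        (x - a) * monic (divideBy a (c ∷ cs)) x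
          ≈⟨ +-identityʳ _ ⟨
        (x - a) * monic (divideBy a (c ∷ cs)) x + 0#
          ≈⟨ +-congˡ (roots zero) ⟨
        (x - a) * monic (divideBy a (c ∷ cs)) x + monic (c ∷ cs) a
          ≈⟨ monic-divideBy a c cs x ⟨
        monic (c ∷ cs) x
          ≈⟨ roots (suc i) ⟩
        0# ∎)
        where
        x = f (suc i)
        x-a≉0 : ¬ x - a ≈ 0#
        x-a≉0 e with () ← f-inj {suc i} {zero} (x-y≈0⇒x≈y e)

    fixed-by-power-≤ : ∀ {N q} → 1 ℕ.< q → (f : Fin N → Carrier) → (∀ {i j} → f i ≈ f j → i ≡ j) →
                           (∀ i → f i ^ q ≈ f i) → N ≤ q
    fixed-by-power-≤ {N} {suc (suc m)} (s≤s _) f f-inj fixed =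
      ≡.subst (N ≤_) (≡.cong (2 ℕ.+_) (List.length-replicate m))
        -- With q = m + 2 these are the coefficients 0, -1, 0, ..., 0 of x^q - x below the leading
        -- term.
        (root-bound (0# ∷ - 1# ∷ replicate m 0#) f f-inj λ i → begin
          0# + f i * (- 1# + f i * monic (replicate m 0#) (f i))
            ≈⟨ +-identityˡ _ ⟩
          f i * (- 1# + f i * monic (replicate m 0#) (f i))
            ≈⟨ *-congˡ (+-congˡ (*-congˡ (monic-zeros m (f i)))) ⟩
          f i * (- 1# + f i * f i ^ m)
            ≈⟨ distribˡ (f i) _ _ ⟩
          f i * - 1# + f i * (f i * f i ^ m)
            ≈⟨ +-cong (trans (sym (-‿distribʳ-* (f i) 1#)) (-‿cong (*-identityʳ (f i)))) (fixed i) ⟩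
          - f i + f i
            ≈⟨ -‿inverseˡ (f i) ⟩
          0# ∎)
      where
      monic-zeros : ∀ m x → monic (replicate m 0#) x ≈ x ^ m
      monic-zeros zero    x = refl
      monic-zeros (suc m) x = trans (+-identityˡ _) (*-congˡ (monic-zeros m x))

    private module Lagrange {k} (E : Enumeration K (suc k)) where
      open Enumeration E
      open import Algebra.Properties.CommutativeMonoid.Sum *-commutativeMonoid
        renaming (sum to prod)

      private
        -- Zero is replaced by 1, so that products over the whole enumeration are products over the units.
        nonzeroPart : Carrier → Carrier → Carrier
        nonzeroPart z x with x ≟ 0#
        ... | yes _ = 1#
        ... | no  _ = z

        nonzeroPart-0 : ∀ z {x} → x ≈ 0# → nonzeroPart z x ≈ 1#
        nonzeroPart-0 z {x} x≈0 with x ≟ 0#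
        ... | yes _   = refl
        ... | no  x≉0 = contradiction x≈0 x≉0

        nonzeroPart-≉0 : ∀ z {x} → ¬ x ≈ 0# → nonzeroPart z x ≈ z
        nonzeroPart-≉0 z {x} x≉0 with x ≟ 0#
        ... | yes x≈0 = contradiction x≈0 x≉0
        ... | no  _   = refl

        prod-≉0 : ∀ {k} (f : Fin k → Carrier) → (∀ i → ¬ f i ≈ 0#) → ¬ prod f ≈ 0#
        prod-≉0 {zero}  f f≉0 = 1≉0
        prod-≉0 {suc k} f f≉0 = *-≉0 (f≉0 zero) (prod-≉0 (f ∘ suc) (f≉0 ∘ suc))

        g : Carrier → Carrier
        g x = nonzeroPart x x

        g-≉0 : ∀ x → ¬ g x ≈ 0#
        g-≉0 x with x ≟ 0#
        ... | yes _   = 1≉0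
        ... | no  x≉0 = x≉0

        g-cong : ∀ {x y} → x ≈ y → g x ≈ g y
        g-cong {x} {y} x≈y with x ≟ 0#
        ... | yes x≈0 = sym (nonzeroPart-0 y (trans (sym x≈y) x≈0))
        ... | no  x≉0 = trans x≈y (sym (nonzeroPart-≉0 y (x≉0 ∘ trans x≈y)))

        g-* : ∀ {y} → ¬ y ≈ 0# → ∀ x → g (y * x) ≈ nonzeroPart y x * g x
        g-* {y} y≉0 x with x ≟ 0#
        ... | yes x≈0 = trans (nonzeroPart-0 _ (trans (*-congˡ x≈0) (zeroʳ y))) (sym (*-identityˡ 1#))
        ... | no  x≉0 = nonzeroPart-≉0 _ (*-≉0 y≉0 x≉0)

        scaling : ∀ y z → y * z ≈ 1# → ∀ i → to (y * from (to (z * from i))) ≡ i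
        scaling y z yz≈1 i = ≡.trans (to-cong (begin
          y * from (to (z * from i))  ≈⟨ *-congˡ (from-to _) ⟩
          y * (z * from i)            ≈⟨ *-assoc y z _ ⟨
          (y * z) * from i            ≈⟨ *-congʳ yz≈1 ⟩
          1# * from i                 ≈⟨ *-identityˡ _ ⟩
          from i                      ∎)) (to-from i)

        nonzero-prod : ∀ {k} y (f : Fin (suc k) → Carrier) i₀ → f i₀ ≈ 0# →
                       (∀ j → ¬ f (punchIn i₀ j) ≈ 0#) → prod (nonzeroPart y ∘ f) ≈ y ^ k
        nonzero-prod {k} y f i₀ fi₀≈0 f≉0 = begin
          prod (nonzeroPart y ∘ f)
            ≈⟨ sum-remove {i = i₀} (nonzeroPart y ∘ f) ⟩
          nonzeroPart y (f i₀) * prod (λ j → nonzeroPart y (f (punchIn i₀ j)))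
            ≈⟨ *-cong (nonzeroPart-0 y fi₀≈0) (trans (sum-cong-≋ (λ j → nonzeroPart-≉0 y (f≉0 j))) (sum-replicate k)) ⟩
          1# * y ^ k
            ≈⟨ *-identityˡ _ ⟩
          y ^ k ∎

      -- Multiplication by a nonzero y permutes the elements. The product P of the nonzero ones
      -- therefore equals y^k P, and P can be cancelled.
      power-size : ∀ y → y ^ suc k ≈ y
      power-size y with y ≟ 0#
      ... | yes y≈0 = trans (*-congʳ y≈0) (trans (zeroˡ _) (sym y≈0))
      ... | no  y≉0 with z , yz≈1 ← inverse y≉0 = begin
        y * y ^ k  ≈⟨ *-congˡ y^k≈1 ⟩
        y * 1#     ≈⟨ *-identityʳ y ⟩
        y          ∎
        where
        σ : Permutation′ (suc k)
        σ = permutation (λ i → to (y * from i)) (λ i → to (z * from i))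
          (scaling y z yz≈1) (scaling z y (trans (*-comm z y) yz≈1))
        P = prod (g ∘ from)
        y^k≈1 : y ^ k ≈ 1#
        y^k≈1 = *-cancelˡ (prod-≉0 (g ∘ from) (g-≉0 ∘ from)) (sym (begin
          P * 1#                                         ≈⟨ *-identityʳ P ⟩
          P                                              ≈⟨ sum-permute (g ∘ from) σ ⟩
          prod (λ i → g (from (to (y * from i))))        ≈⟨ sum-cong-≋ (λ i → trans (g-cong (from-to _)) (g-* y≉0 (from i))) ⟩
          prod (λ i → nonzeroPart y (from i) * g (from i)) ≈⟨ ∑-distrib-+ (nonzeroPart y ∘ from) (g ∘ from) ⟩
          prod (nonzeroPart y ∘ from) * P                ≈⟨ *-congʳ (nonzero-prod y from (to 0#) (from-to 0#) punched) ⟩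
          y ^ k * P                                      ≈⟨ *-comm _ P ⟩
          P * y ^ k                                      ∎))
          where
          punched : ∀ j → ¬ from (punchIn (to 0#) j) ≈ 0#
          punched j e = punchInᵢ≢i (to 0#) j (≡.trans (≡.sym (to-from _)) (to-cong e))

    power-size : ∀ {N} → Enumeration K N → ∀ y → y ^ N ≈ y
    power-size {zero}  E = contradiction (Enumeration.to E 0#) λ ()
    power-size {suc k} E = Lagrange.power-size E

  -- Iterating over ys cuts e down to an idempotent below which every y ∈ ys is zero or invertible.
  module PrimitiveIdempotent
    (R : CommutativeRing 0ℓ 0ℓ) (_≟_ : ∀ x y → Dec (CommutativeRing._≈_ R x y)) where
    open CommutativeRing R hiding (zero)
    open import Algebra.Properties.Semiring.Exp semiring
    open import Algebra.Properties.CommutativeSemigroup *-commutativeSemigroup using (interchange)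
    open import Relation.Binary.Reasoning.Setoid setoid

    module _ (m : ℕ) (fixed : ∀ y → y ^ suc (suc m) ≈ y) where

      power-idempotent : ∀ y → y ^ suc m * y ^ suc m ≈ y ^ suc m
      power-idempotent y = begin
        (y * y ^ m) * (y * y ^ m)  ≈⟨ *-congʳ (*-comm y _) ⟩
        (y ^ m * y) * (y * y ^ m)  ≈⟨ *-assoc _ y _ ⟩
        y ^ m * y ^ suc (suc m)    ≈⟨ *-congˡ (fixed y) ⟩
        y ^ m * y                  ≈⟨ *-comm _ y ⟩
        y ^ suc m                  ∎

      Resolves : Carrier → Carrier → Set
      Resolves e y = (e * y ≈ 0#) ⊎ (e * y ^ suc m ≈ e)

      *-swap : ∀ {e e′ s} → e′ ≈ e * s → ∀ z → e′ * z ≈ s * (e * z)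
      *-swap {e} {e′} {s} e′≈es z = trans (*-congʳ (trans e′≈es (*-comm e s))) (*-assoc s e z)

      -- Multiples of `e` inherit both alternatives, so an element dealt with once stays resolved
      -- under all later refinements. This is why `refine` also returns the cofactor `s`.
      resolves-* : ∀ {e e′ s} → e′ ≈ e * s → ∀ {y} → Resolves e y → Resolves e′ y
      resolves-* {s = s} e′≈es {y} (inj₁ p) =
        inj₁ (trans (*-swap e′≈es y) (trans (*-congˡ p) (zeroʳ s)))
      resolves-* {e} {s = s} e′≈es {y} (inj₂ p) =
        inj₂ (trans (*-swap e′≈es _) (trans (*-congˡ p) (trans (*-comm s e) (sym e′≈es))))

      -- The idempotent y^(q - 1), with q = m + 2, splits e. If e y^(q - 1) is nonzero it replaces
      -- e, and below it y^(q - 1) acts as the identity. If it is zero, then e y = e y^(q - 1) y = 0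
      -- already.
      refine : ∀ ys e → ¬ e ≈ 0# → e * e ≈ e →
                  ∃ λ e′ → ¬ e′ ≈ 0# × e′ * e′ ≈ e′ × (∃ λ s → e′ ≈ e * s) × All (Resolves e′) ys
      refine []       e e≉0 ee≈e = e , e≉0 , ee≈e , (1# , sym (*-identityʳ e)) , []
      refine (y ∷ ys) e e≉0 ee≈e with (e * y ^ suc m) ≟ 0#
      ... | yes ey≈0 with e′ , e′≉0 , idem , (s , e′≈es) , res ← refine ys e e≉0 ee≈e =
        e′ , e′≉0 , idem , (s , e′≈es) , resolves-* e′≈es (inj₁ (begin
          e * y                  ≈⟨ *-congˡ (trans (*-comm _ y) (fixed y)) ⟨
          e * (y ^ suc m * y)    ≈⟨ *-assoc e _ y ⟨
          (e * y ^ suc m) * y    ≈⟨ *-congʳ ey≈0 ⟩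
          0# * y                 ≈⟨ zeroˡ y ⟩
          0#                     ∎)) ∷ res
      ... | no ey≉0 with e′ , e′≉0 , idem , (s , e′≈es) , res ←
          refine ys (e * y ^ suc m) ey≉0 (trans (interchange _ _ _ _) (*-cong ee≈e (power-idempotent y))) =
        e′ , e′≉0 , idem , (y ^ suc m * s , trans e′≈es (*-assoc e _ s)) ,
        resolves-* e′≈es (inj₂ (trans (*-assoc e _ _) (*-congˡ (power-idempotent y)))) ∷ res

-- Counting a field generated by one element over ℤ/p.

module FieldSize where

  open Frobenius
  open GroupRing
  open Fields
  open import Algebra.Bundles using (CommutativeRing)
  open import Data.Nat using (ℕ; zero; suc; _≤_; _<_; z<s; NonZero)
  import Data.Nat as ℕ
  import Data.Nat.Properties as ℕ
  open import Data.Nat.Coprimality using (prime⇒coprime; coprime-Bézout)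
  open import Data.Nat.GCD using (module Bézout)
  open import Data.Nat.DivMod using (_%_; _/_; m≡m%n+[m/n]*n)
  open import Data.Nat.Divisibility using (divides-refl; ∣-refl)
  open import Data.Nat.Primality using (Prime; prime⇒nonZero; prime⇒nonTrivial)
  open import Data.Fin using (Fin; zero; suc; toℕ; combine; remQuot)
  open import Data.Fin.Properties using (toℕ-injective; toℕ<n; remQuot-combine; combine-remQuot)
  open import Data.List.Relation.Unary.Any as Any using (Any)
  open import Data.List.Membership.Propositional using (lose)
  open import Data.Vec using (Vec; []; _∷_; zipWith)
  open import Data.Product using (_,_; ∃; _×_; proj₁; proj₂)
  open import Function using (_∘_)
  open import Relation.Nullary using (¬_; Dec; yes; no; contradiction)
  open import Relation.Nullary.Decidable using (map′)
  open import Relation.Binary.Definitions using (tri<; tri≈; tri>)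
  open import Relation.Binary.PropositionalEquality as ≡ using (_≡_)

  module _ {k : ℕ} where
    encode : ∀ {r} → Vec (Fin k) r → Fin (k ℕ.^ r)
    encode []      = zero
    encode (a ∷ u) = combine a (encode u)

    decode : ∀ r → Fin (k ℕ.^ r) → Vec (Fin k) r
    decode zero    i = []
    decode (suc r) i with a , j ← remQuot {k} (k ℕ.^ r) i = a ∷ decode r j

    decode-encode : ∀ {r} (u : Vec (Fin k) r) → decode r (encode u) ≡ u
    decode-encode []              = ≡.refl
    decode-encode {suc r} (a ∷ u) =
      ≡.cong₂ (λ z j → z ∷ decode r j) (≡.cong proj₁ e) (≡.cong proj₂ e) ▹ decode-encode u
      where
      e = remQuot-combine {k} {k ℕ.^ r} a (encode u)
      _▹_ : ∀ {v : Vec (Fin k) (suc r)} {w} → v ≡ a ∷ w → w ≡ u → v ≡ a ∷ u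
      p ▹ ≡.refl = p

    encode-decode : ∀ r i → encode (decode r i) ≡ i
    encode-decode zero    zero = ≡.refl
    encode-decode (suc r) i =
      ≡.trans (≡.cong (combine (proj₁ aj)) (encode-decode r (proj₂ aj))) (combine-remQuot {k} (k ℕ.^ r) i)
      where aj = remQuot {k} (k ℕ.^ r) i

  module Cardinality (K : Field) {p : ℕ} (p-prime : Prime p) where
    open Field K hiding (zero)
    open import Algebra.Properties.Semiring.Exp semiring
    open import Algebra.Properties.Semiring.Mult semiring renaming (_×_ to _·_)
    open import Algebra.Properties.CommutativeSemigroup (CommutativeRing.+-commutativeSemigroup commutativeRing)
      using (interchange)
    open import Algebra.Properties.Ring ring
    open import Relation.Binary.Reasoning.Setoid setoid
    open CharacteristicP commutativeRing
    open FieldProperties K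

    private instance
      p-nonZero : NonZero p
      p-nonZero = prime⇒nonZero p-prime

    1<p : 1 < p
    1<p = ℕ.nonTrivial⇒n>1 p {{prime⇒nonTrivial p-prime}}

    open ModularAddition p

    module Span (char : p · 1# ≈ 0#) (ξ : Carrier) where

      reduce-· : ∀ k x → toℕ (reduce k) · x ≈ k · x
      reduce-· k x = begin
        toℕ (reduce k) · x                 ≈⟨ ×-congˡ (toℕ-reduce k) ⟩
        (k % p) · x                        ≈⟨ +-identityʳ _ ⟨
        (k % p) · x + 0#                   ≈⟨ +-congˡ (∣⇒·≈0 char (divides-refl (k / p)) x) ⟨
        (k % p) · x + (k / p ℕ.* p) · x    ≈⟨ ×-homo-+ x (k % p) _ ⟨
        (k % p ℕ.+ k / p ℕ.* p) · x        ≈⟨ ×-congˡ (m≡m%n+[m/n]*n k p) ⟨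
        k · x                              ∎

      -- The highest power comes first, so that admitting the next power of ξ just adds a
      -- coefficient at the head.
      combination : ∀ {r} → Vec (Fin p) r → Carrier
      combination []              = 0#
      combination {suc r} (c ∷ u) = toℕ c · ξ ^ r + combination u

      Span : ℕ → Carrier → Set
      Span r x = ∃ λ (u : Vec (Fin p) r) → x ≈ combination u

      span-resp : ∀ {r x y} → x ≈ y → Span r x → Span r y
      span-resp x≈y (u , e) = u , trans (sym x≈y) e

      span? : ∀ r x → Dec (Span r x)
      span? r x = map′ Any.satisfied (λ (u , e) → lose (∈-allVecs u) e)
        (Any.any? (λ u → x ≟ combination u) (allVecs p r))

      span-0 : ∀ r → Span r 0#
      span-0 zero    = [] , refl
      span-0 (suc r) with u , e ← span-0 r = reduce 0 ∷ u , trans e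
        (trans (sym (+-identityˡ _)) (+-congʳ (sym (reduce-· 0 (ξ ^ r)))))

      span-suc : ∀ {r x} → Span r x → Span (suc r) x
      span-suc {r} (u , e) = reduce 0 ∷ u , trans e
        (trans (sym (+-identityˡ _)) (+-congʳ (sym (reduce-· 0 (ξ ^ r)))))

      span-top : ∀ r → Span (suc r) (ξ ^ r)
      span-top r with u , e ← span-0 r = reduce 1 ∷ u , trans (sym (+-identityʳ _))
        (+-cong (trans (sym (+-identityʳ _)) (sym (reduce-· 1 (ξ ^ r)))) e)

      span-+ : ∀ {r x y} → Span r x → Span r y → Span r (x + y)
      span-+ (u , e) (v , f) = zipWith _⊕_ u v , trans (+-cong e f) (combination-+ u v)
        where
        combination-+ : ∀ {r} (u v : Vec (Fin p) r) →
                        combination u + combination v ≈ combination (zipWith _⊕_ u v)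
        combination-+ []      []      = +-identityˡ 0#
        combination-+ (a ∷ u) (b ∷ v) = trans (interchange _ _ _ _) (+-cong
          (trans (sym (×-homo-+ _ (toℕ a) (toℕ b))) (sym (reduce-· (toℕ a ℕ.+ toℕ b) _)))
          (combination-+ u v))

      span-· : ∀ {r x} k → Span r x → Span r (k · x)
      span-· zero    s = span-0 _
      span-· (suc k) s = span-+ s (span-· k s)

      span-neg : ∀ {r x} → Span r x → Span r (- x)
      span-neg {r} {x} s = span-resp (+-inverseʳ-unique x (ℕ.pred p · x) (begin
        suc (ℕ.pred p) · x  ≈⟨ ×-congˡ (ℕ.suc-pred p) ⟩
        p · x               ≈⟨ ∣⇒·≈0 {p} char {p} ∣-refl x ⟩
        0#                  ∎)) (span-· (ℕ.pred p) s)

      span-ξ* : ∀ {r x} → Span r x → Span (suc r) (ξ * x)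
      span-ξ* ([] , e) = span-resp (sym (trans (*-congˡ e) (zeroʳ ξ))) (span-0 1)
      span-ξ* {suc r} (c ∷ u , e) = span-resp (sym (begin
        ξ * _                                    ≈⟨ *-congˡ e ⟩
        ξ * (toℕ c · ξ ^ r + combination u)      ≈⟨ distribˡ ξ _ _ ⟩
        ξ * (toℕ c · ξ ^ r) + ξ * combination u  ≈⟨ +-congʳ (×-comm-* (toℕ c) ξ (ξ ^ r)) ⟩
        toℕ c · ξ ^ suc r + ξ * combination u    ∎))
        (span-+ (span-· (toℕ c) (span-top (suc r))) (span-suc (span-ξ* (u , refl))))

      -- `k` is invertible modulo p: the two Bézout cases provide b with b k ≡ -1 and with b k ≡ 1.
      span-cancel-· : ∀ {r x k} → 0 < k → k < p → Span r (k · x) → Span r x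
      span-cancel-· {r} {x} {k} 0<k k<p s
        with coprime-Bézout (prime⇒coprime p-prime {{ℕ.>-nonZero 0<k}} k<p)
      ... | Bézout.+- a b eq = span-resp (sym (+-inverseˡ-unique x (b · (k · x)) (begin
          x + b · (k · x)        ≈⟨ +-congˡ (×-assocˡ x b k) ⟩
          suc (b ℕ.* k) · x      ≈⟨ ×-congˡ eq ⟩
          (a ℕ.* p) · x          ≈⟨ ∣⇒·≈0 char (divides-refl a) x ⟩
          0#                     ∎))) (span-neg (span-· b s))
      ... | Bézout.-+ a b eq = span-resp (begin
          b · (k · x)            ≈⟨ ×-assocˡ x b k ⟩
          (b ℕ.* k) · x          ≈⟨ ×-congˡ eq ⟨
          x + (a ℕ.* p) · x      ≈⟨ +-congˡ (∣⇒·≈0 char (divides-refl a) x) ⟩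
          x + 0#                 ≈⟨ +-identityʳ x ⟩
          x                      ∎) (span-· b s)

      Independent : ℕ → Set
      Independent r = ∀ (u v : Vec (Fin p) r) → combination u ≈ combination v → u ≡ v

      independent-0 : Independent 0
      independent-0 [] [] _ = ≡.refl

      -- The difference isolates (b - a) ξ^r in the span of the lower powers, and the factor b - a,
      -- strictly between 0 and p, can be cancelled.
      dependent : ∀ {r} a b (u v : Vec (Fin p) r) → toℕ a < toℕ b →
                  combination (a ∷ u) ≈ combination (b ∷ v) → Span r (ξ ^ r)
      dependent {r} a b u v a<b eq = span-cancel-· (ℕ.m<n⇒0<n∸m a<b)
        (ℕ.≤-<-trans (ℕ.m∸n≤m (toℕ b) (toℕ a)) (toℕ<n b))
        (span-resp difference (span-+ (u , refl) (span-neg (v , refl))))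
        where
        k = toℕ b ℕ.∸ toℕ a
        difference : combination u - combination v ≈ k · ξ ^ r
        difference = +-cancelʳ (combination v) _ _ (+-cancelˡ (toℕ a · ξ ^ r) _ _ (begin
          toℕ a · ξ ^ r + (combination u - combination v + combination v)
            ≈⟨ +-congˡ (trans (+-assoc _ _ _) (trans (+-congˡ (-‿inverseˡ _)) (+-identityʳ _))) ⟩
          toℕ a · ξ ^ r + combination u
            ≈⟨ eq ⟩
          toℕ b · ξ ^ r + combination v
            ≈⟨ +-congʳ (×-congˡ (ℕ.m+[n∸m]≡n (ℕ.<⇒≤ a<b))) ⟨
          (toℕ a ℕ.+ k) · ξ ^ r + combination v
            ≈⟨ +-congʳ (×-homo-+ (ξ ^ r) (toℕ a) k) ⟩
          (toℕ a · ξ ^ r + k · ξ ^ r) + combination v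
            ≈⟨ +-assoc _ _ _ ⟩
          toℕ a · ξ ^ r + (k · ξ ^ r + combination v) ∎))

      independent-suc : ∀ {r} → Independent r → ¬ Span r (ξ ^ r) → Independent (suc r)
      independent-suc {r} ind ∉span (a ∷ u) (b ∷ v) eq with ℕ.<-cmp (toℕ a) (toℕ b)
      ... | tri< a<b _ _ = contradiction (dependent a b u v a<b eq) ∉span
      ... | tri≈ _ a≡b _ with ≡.refl ← toℕ-injective a≡b = ≡.cong (a ∷_) (ind u v (+-cancelˡ _ _ _ eq))
      ... | tri> _ _ b<a = contradiction (dependent b a v u b<a (sym eq)) ∉span

      independent-injective : ∀ {r} → Independent r → ∀ {i j} →
        combination (decode r i) ≈ combination (decode r j) → i ≡ j
      independent-injective {r} ind {i} {j} e = ≡.trans (≡.sym (encode-decode r i))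
        (≡.trans (≡.cong encode (ind (decode r i) (decode r j) e)) (encode-decode r j))

      -- If ξ^r depends on the lower powers, the span is closed under multiplication by ξ: the one
      -- new power that appears is folded back. It also contains 1, so `generated` exhausts the
      -- field.
      span-all : ∀ {r} →
        (∀ (P : Carrier → Set) → (∀ {v w} → v ≈ w → P v → P w) → P 0# →
           (∀ c w → P w → P (c · 1# + ξ * w)) → ∀ v → P v) →
        Span r (ξ ^ r) → ∀ x → Span r x
      span-all {zero} _ ([] , 1≈0) = contradiction 1≈0 1≉0
      span-all {suc r} generated top = generated (Span (suc r)) span-resp (span-0 _)
        λ c w s → span-+ (span-· c (span-1 r)) (span-drop (span-ξ* s))
        where
        span-1 : ∀ r → Span (suc r) 1#
        span-1 zero    = span-top 0
        span-1 (suc r) = span-suc (span-1 r)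
        span-drop : ∀ {x} → Span (suc (suc r)) x → Span (suc r) x
        span-drop (c ∷ u , e) = span-resp (sym e) (span-+ (span-· (toℕ c) top) (u , refl))

      enumeration : ∀ {r} → Independent r → (∀ x → Span r x) → Enumeration K (p ℕ.^ r)
      enumeration {r} ind spans = record
        { from    = combination ∘ decode r
        ; to      = encode ∘ coordinates
        ; to-cong = λ {x} {y} x≈y → ≡.cong encode (ind (coordinates x) (coordinates y)
            (trans (sym (proj₂ (spans x))) (trans x≈y (proj₂ (spans y)))))
        ; to-from = λ i → independent-injective ind (from-to (combination (decode r i)))
        ; from-to = from-to
        }
        where
        coordinates : Carrier → Vec (Fin p) r
        coordinates = proj₁ ∘ spans
        from-to : ∀ x → combination (decode r (encode (coordinates x))) ≈ x
        from-to x = trans (reflexive (≡.cong combination (decode-encode (coordinates x)))) (sym (proj₂ (spans x)))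

      module _
        (generated : ∀ (P : Carrier → Set) → (∀ {v w} → v ≈ w → P v → P w) → P 0# →
                     (∀ c w → P w → P (c · 1# + ξ * w)) → ∀ v → P v)
        (e : ℕ) (fixed : ∀ x → x ^ (p ℕ.^ suc e) ≈ x)
        (long-orbit : ∀ i → i < e → ¬ ξ ^ (p ℕ.^ suc i) ≈ ξ)
        where

        independent-bound : ∀ {r} → Independent r → r ≤ suc e
        independent-bound {r} ind = ℕ.≮⇒≥ λ e<r → ℕ.<⇒≱ (ℕ.^-monoʳ-< p 1<p e<r)
          (fixed-by-power-≤ (ℕ.^-monoʳ-< p 1<p {0} {suc e} z<s) (combination ∘ decode r)
            (independent-injective ind) (λ i → fixed _))

        -- Powers of ξ are added until the next one is dependent. The fuel runs out only at r = e +
        -- 2, which `independent-bound` excludes.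
        search : ∀ fuel r → r ℕ.+ fuel ≡ suc (suc e) → Independent r → ∃ λ r → Independent r × Span r (ξ ^ r)
        search zero r eq ind = contradiction (independent-bound ind)
          (ℕ.<⇒≱ (ℕ.≤-reflexive (≡.sym (≡.trans (≡.sym (ℕ.+-identityʳ r)) eq))))
        search (suc fuel) r eq ind with span? r (ξ ^ r)
        ... | yes top   = r , ind , top
        ... | no  ∉span = search fuel (suc r) (≡.trans (≡.sym (ℕ.+-suc r fuel)) eq) (independent-suc ind ∉span)

        full-enumeration : Enumeration K (p ℕ.^ suc e)
        full-enumeration with search (suc (suc e)) 0 ≡.refl independent-0
        ... | zero  , _   , ([] , 1≈0) = contradiction 1≈0 1≉0
        ... | suc i , ind , top with ℕ.<-cmp i e
        ...   | tri< i<e _ _ = contradiction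
          (power-size (enumeration ind (span-all generated top)) ξ) (long-orbit i i<e)
        ...   | tri≈ _ ≡.refl _ = enumeration ind (span-all generated top)
        ...   | tri> _ _ e<i = contradiction (ℕ.≤-pred (independent-bound ind)) (ℕ.<⇒≱ e<i)

-- Existence of a field with p^(e + 1) elements.

module FiniteFields where

  open Frobenius
  open GroupRing
  open Fields
  open FieldSize
  open import Algebra.Bundles using (CommutativeRing)
  open import Data.Nat using (ℕ; zero; suc; _<_; s≤s; z<s; NonZero)
  import Data.Nat as ℕ
  import Data.Nat.Properties as ℕ
  open import Data.Nat.Primality using (Prime; prime⇒nonZero; prime⇒nonTrivial)
  open import Data.List using (List)
  open import Data.List.Membership.Propositional using (_∈_)
  open import Data.List.Relation.Unary.All as All using (All)
  open import Data.Product using (_,_; ∃; _×_; proj₁; proj₂)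
  open import Data.Sum using (inj₁; inj₂)
  open import Relation.Nullary using (¬_; Dec; contradiction)
  open import Relation.Binary.PropositionalEquality as ≡ using (_≡_)
  open import Level using (0ℓ)

  module QuotientOperations (R : CommutativeRing 0ℓ 0ℓ) (a : CommutativeRing.Carrier R) where
    open CommutativeRing R hiding (zero)
    open import Algebra.Properties.Semiring.Exp semiring
    open import Algebra.Properties.Semiring.Mult semiring renaming (_×_ to _·_)
    open import Algebra.Properties.Semiring.Exp (CommutativeRing.semiring (annihilatorQuotient R a)) using () renaming (_^_ to _^′_)
    open import Algebra.Properties.Semiring.Mult (CommutativeRing.semiring (annihilatorQuotient R a)) using () renaming (_×_ to _·′_)

    -- The multiplication is the same, but the two power functions are instantiated at bundles that
    -- differ in their equality, so for a variable exponent they agree only by induction.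
    ^-quotient : ∀ x k → x ^′ k ≡ x ^ k
    ^-quotient x zero    = ≡.refl
    ^-quotient x (suc k) = ≡.cong (x *_) (^-quotient x k)

    ·-quotient : ∀ k x → k ·′ x ≡ k · x
    ·-quotient zero    x = ≡.refl
    ·-quotient (suc k) x = ≡.cong (x +_) (·-quotient k x)

  module RingNotation (R : CommutativeRing 0ℓ 0ℓ) where
    open CommutativeRing R public
    open import Algebra.Properties.Semiring.Exp semiring public
    open import Algebra.Properties.Semiring.Mult semiring public renaming (_×_ to _·_)
    open ShortOrbits R public

  record GeneratedRing (p n e : ℕ) : Set₁ where
    field
      commutativeRing : CommutativeRing 0ℓ 0ℓ
    open RingNotation commutativeRing public
    field
      _≟_           : ∀ x y → Dec (x ≈ y)
      elements      : List Carrier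
      ∈-elements    : ∀ x → x ∈ elements
      ξ             : Carrier
      generated     : (P : Carrier → Set) → (∀ {v w} → v ≈ w → P v → P w) → P 0# →
                      (∀ c w → P w → P (c · 1# + ξ * w)) → ∀ v → P v
      char          : p · 1# ≈ 0#
      ξ^n≈1         : ξ ^ n ≈ 1#
      shortOrbits≉0 : ¬ shortOrbits p ξ e ≈ 0#

  module FieldConstruction {p : ℕ} (p-prime : Prime p) (e m : ℕ) (q≡ : p ℕ.^ suc e ≡ suc (suc m))
    (R : GeneratedRing p (suc m) e) where

    open GeneratedRing R hiding (zero)
    open import Algebra.Properties.CommutativeSemiring.Exp commutativeSemiring using (^-distrib-*)
    open import Algebra.Properties.CommutativeSemigroup *-commutativeSemigroup using (x∙yz≈y∙xz)
    open import Algebra.Properties.Ring ring using (x[y-z]≈xy-xz)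
    open CharacteristicP commutativeRing
    open PrimitiveIdempotent commutativeRing _≟_
    open import Relation.Binary.Reasoning.Setoid setoid

    private instance
      p-nonZero : NonZero p
      p-nonZero = prime⇒nonZero p-prime

    n q : ℕ
    n = suc m
    q = suc n

    frobenius-q : ∀ x y → (x + y) ^ q ≈ x ^ q + y ^ q
    frobenius-q = ≡.subst (λ k → ∀ x y → (x + y) ^ k ≈ x ^ k + y ^ k) q≡
      (iterated-frobenius-+ p-prime char (suc e))

    1^ : ∀ k → 1# ^ k ≈ 1#
    1^ zero    = refl
    1^ (suc k) = trans (*-identityˡ _) (1^ k)

    fixed-prime : ∀ c → (c · 1#) ^ q ≈ c · 1#
    fixed-prime zero    = zeroˡ _
    fixed-prime (suc c) = trans (frobenius-q 1# (c · 1#)) (+-cong (1^ q) (fixed-prime c))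

    -- The map y ↦ y^q is additive and multiplicative, fixes the multiples of 1, and fixes ξ because
    -- ξ^q = ξ ξ^n.
    fixed : ∀ y → y ^ q ≈ y
    fixed = generated (λ y → y ^ q ≈ y)
      (λ v≈w fix → trans (^-congˡ q (sym v≈w)) (trans fix v≈w)) (zeroˡ _) λ c w w^q≈w → begin
        (c · 1# + ξ * w) ^ q          ≈⟨ frobenius-q (c · 1#) (ξ * w) ⟩
        (c · 1#) ^ q + (ξ * w) ^ q    ≈⟨ +-cong (fixed-prime c) (^-distrib-* ξ w q) ⟩
        c · 1# + ξ ^ q * w ^ q        ≈⟨ +-congˡ (*-cong (trans (*-congˡ ξ^n≈1) (*-identityʳ ξ)) w^q≈w) ⟩
        c · 1# + ξ * w                ∎

    t : Carrier
    t = shortOrbits p ξ e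

    t^n≉0 : ¬ t ^ n ≈ 0#
    t^n≉0 t^n≈0 = shortOrbits≉0 (trans (sym (fixed t)) (trans (*-congˡ t^n≈0) (zeroʳ t)))

    private
      refined = refine m fixed elements (t ^ n) t^n≉0 (power-idempotent m fixed t)

    ε : Carrier
    ε = proj₁ refined

    ε≉0 : ¬ ε ≈ 0#
    ε≉0 = proj₁ (proj₂ refined)

    εε≈ε : ε * ε ≈ ε
    εε≈ε = proj₁ (proj₂ (proj₂ refined))

    resolves : ∀ y → Resolves m fixed ε y
    resolves y = All.lookup (proj₂ (proj₂ (proj₂ (proj₂ refined)))) (∈-elements y)

    -- t survives in the residue field: ε is a multiple of t^n and hence of t, so ε t = 0 would give
    -- ε = ε ε = 0.
    εt≉0 : ¬ ε * t ≈ 0#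
    εt≉0 εt≈0 with s , ε≈t^n*s ← proj₁ (proj₂ (proj₂ (proj₂ refined))) = ε≉0 (begin
      ε                     ≈⟨ εε≈ε ⟨
      ε * ε                 ≈⟨ *-congˡ ε≈t^n*s ⟩
      ε * (t * t ^ m * s)   ≈⟨ *-congˡ (*-assoc t (t ^ m) s) ⟩
      ε * (t * (t ^ m * s)) ≈⟨ *-assoc ε t _ ⟨
      ε * t * (t ^ m * s)   ≈⟨ *-congʳ εt≈0 ⟩
      0# * (t ^ m * s)      ≈⟨ zeroˡ _ ⟩
      0#                    ∎)

    K : Field
    K = record
      { commutativeRing = annihilatorQuotient commutativeRing ε
      ; _≟_     = λ x y → (ε * x) ≟ (ε * y)
      ; 1≉0     = λ ε1≈ε0 → ε≉0 (trans (sym (*-identityʳ ε)) (trans ε1≈ε0 (zeroʳ ε)))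
      -- A nonzero x satisfies x^(q - 1) = 1 below ε, and m = q - 2.
      ; inverse = λ {x} εx≉ε0 → x ^ m , invert x εx≉ε0
      }
      where
      invert : ∀ x → ¬ ε * x ≈ ε * 0# → ε * (x * x ^ m) ≈ ε * 1#
      invert x εx≉ε0 with resolves x
      ... | inj₁ εx≈0   = contradiction (trans εx≈0 (sym (zeroʳ ε))) εx≉ε0
      ... | inj₂ εx^n≈ε = trans εx^n≈ε (sym (*-identityʳ ε))

    open QuotientOperations commutativeRing ε

    shortOrbits-vanish : ∀ {i} k → i < k → ε * (ξ ^ ℕ.pred (p ℕ.^ suc i) + - 1#) ≈ 0# →
                         ε * shortOrbits p ξ k ≈ 0#
    shortOrbits-vanish {i} (suc k) i<1+k factor≈0 with ℕ.m≤n⇒m<n∨m≡n (ℕ.≤-pred i<1+k)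
    ... | inj₁ i<k  = trans (x∙yz≈y∙xz ε _ _) (trans (*-congˡ (shortOrbits-vanish k i<k factor≈0)) (zeroʳ _))
    ... | inj₂ ≡.refl = trans (sym (*-assoc ε _ _)) (trans (*-congʳ factor≈0) (zeroˡ _))

    -- ξ is a unit with inverse ξ^m, so an equality ξ^(p^(i + 1)) = ξ in the residue field could be
    -- divided by ξ. That would kill a factor of t, and t is nonzero there.
    long-orbit : ∀ i → i < e → ¬ ε * ξ ^ (p ℕ.^ suc i) ≈ ε * ξ
    long-orbit i i<e eq = εt≉0 (shortOrbits-vanish e i<e (begin
      ε * (ξ ^ j + - 1#)        ≈⟨ x[y-z]≈xy-xz ε (ξ ^ j) 1# ⟩
      ε * ξ ^ j + - (ε * 1#)    ≈⟨ +-congʳ εξ^j≈ε1 ⟩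
      ε * 1# + - (ε * 1#)       ≈⟨ -‿inverseʳ _ ⟩
      0#                        ∎))
      where
      j = ℕ.pred (p ℕ.^ suc i)
      cancel : ∀ y → ξ ^ m * (ε * (ξ * y)) ≈ ε * y
      cancel y = begin
        ξ ^ m * (ε * (ξ * y))   ≈⟨ x∙yz≈y∙xz (ξ ^ m) ε _ ⟩
        ε * (ξ ^ m * (ξ * y))   ≈⟨ *-congˡ (x∙yz≈y∙xz (ξ ^ m) ξ y) ⟩
        ε * (ξ * (ξ ^ m * y))   ≈⟨ *-congˡ (*-assoc ξ (ξ ^ m) y) ⟨
        ε * (ξ ^ n * y)         ≈⟨ *-congˡ (trans (*-congʳ ξ^n≈1) (*-identityˡ y)) ⟩
        ε * y                   ∎
      εξ^j≈ε1 : ε * ξ ^ j ≈ ε * 1#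
      εξ^j≈ε1 = begin
        ε * ξ ^ j                          ≈⟨ cancel (ξ ^ j) ⟨
        ξ ^ m * (ε * ξ ^ suc j)            ≈⟨ *-congˡ (*-congˡ (^-congʳ ξ (ℕ.suc-pred (p ℕ.^ suc i) {{ℕ.m^n≢0 p (suc i)}}))) ⟩
        ξ ^ m * (ε * ξ ^ (p ℕ.^ suc i))    ≈⟨ *-congˡ eq ⟩
        ξ ^ m * (ε * ξ)                    ≈⟨ *-congˡ (*-congˡ (*-identityʳ ξ)) ⟨
        ξ ^ m * (ε * (ξ * 1#))             ≈⟨ cancel 1# ⟩
        ε * 1#                             ∎

    enumerated : Enumeration K (p ℕ.^ suc e)
    enumerated = full-enumeration
      -- A predicate that respects the coarser equality of `K` also respects that of the group ring,
      -- so the induction principle descends to the quotient.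
      (λ P resp P0 P+ → generated P (λ v≈w → resp (*-congˡ v≈w)) P0
        λ c w Pw → ≡.subst P (≡.cong (λ z → z + ξ * w) (·-quotient c 1#)) (P+ c w Pw))
      e
      (λ x → *-congˡ (trans (reflexive (^-quotient x (p ℕ.^ suc e))) (trans (^-congʳ x q≡) (fixed x))))
      (λ i i<e eq → long-orbit i i<e (trans (*-congˡ (reflexive (≡.sym (^-quotient ξ (p ℕ.^ suc i))))) eq))
      where
      open Cardinality K p-prime
      open Span (*-congˡ (trans (reflexive (·-quotient p 1#)) char)) ξ

  generatedRing : ∀ {p e m} → Prime p → p ℕ.^ suc e ≡ suc (suc m) → GeneratedRing p (suc m) e
  generatedRing {p} {e} {m} p-prime q≡ = record
    { commutativeRing = cyclicRing
    ; _≟_           = _≟V_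
    ; elements      = allVecs p (suc m)
    ; ∈-elements    = ∈-allVecs
    ; ξ             = ξ
    ; generated     = generated
    ; char          = characteristic
    ; ξ^n≈1         = ξ^n≡1
    ; shortOrbits≉0 = shortOrbits-≢0 (ℕ.nonTrivial⇒n>1 p {{prime⇒nonTrivial p-prime}}) e (ℕ.≤-reflexive q≡)
    }
    where open CyclicGroupRing p {{prime⇒nonZero p-prime}} m

  finite-field : ∀ {p} → Prime p → ∀ e → ∃ λ K → Enumeration K (p ℕ.^ suc e)
  finite-field {p} p-prime e = go (p ℕ.^ suc e) ≡.refl (ℕ.^-monoʳ-< p 1<p {0} {suc e} z<s)
    where
    1<p : 1 < p
    1<p = ℕ.nonTrivial⇒n>1 p {{prime⇒nonTrivial p-prime}}
    -- The power is generalised to a variable so that matching can write it as `suc (suc m)`; the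
    -- cyclic group then has order q - 1 = `suc m`.
    go : ∀ q → p ℕ.^ suc e ≡ q → 1 < q → ∃ λ K → Enumeration K (p ℕ.^ suc e)
    go (suc (suc m)) q≡ _ = K , enumerated
      where open FieldConstruction p-prime e m q≡ (generatedRing p-prime q≡)
    go (suc zero) q≡ (s≤s ())

open import Defs
open Fields
open FiniteFields
open import Algebra.Bundles using (CommutativeRing)
open import Data.Nat using (ℕ; zero; suc; _+_; _*_; _∸_; _^_; _≤_; _<_; _≥_; z≤n; s≤s)
import Data.Nat.Properties as ℕ
open import Data.Nat.Combinatorics using (_C_; nCk+nC[k+1]≡[n+1]C[k+1]; k>n⇒nCk≡0)
open import Data.Fin using (Fin; zero; suc; punchIn; punchOut; funToFin; finToFun; combine)
open import Data.Fin.Properties using (injective⇒≤; any?; all?; punchIn-punchOut; finToFun-funToFin; funToFin-finToFin) renaming (_≟_ to _≟F_)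
open import Data.List using (List; []; _∷_; [_]; _++_; length; lookup; cartesianProductWith; allFin; map)
import Data.List.Properties as List
open import Data.List.Relation.Unary.Any as Any using (Any; here)
open import Data.List.Relation.Unary.Any.Properties as Any using (lookup-index; ++⁺ˡ; ++⁺ʳ; cartesianProductWith⁺)
open import Data.List.Membership.Propositional.Properties using (∈-allFin)
open import Data.Product using (_,_; ∃; proj₁; proj₂)
open import Function using (_∘_)
open import Relation.Nullary using (¬_; Dec; yes; no; contradiction; ¬?)
open import Relation.Nullary.Decidable using (decidable-stable)
open import Relation.Binary.PropositionalEquality as ≡ using (_≡_; _≗_)

-- Pigeonhole and counting.

funToFin-cong : ∀ {m n} {f g : Fin m → Fin n} → f ≗ g → funToFin f ≡ funToFin g
funToFin-cong {zero}  f≗g = ≡.refl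
funToFin-cong {suc m} f≗g = ≡.cong₂ combine (f≗g zero) (funToFin-cong (f≗g ∘ suc))

length-cartesianProductWith : ∀ {A B C : Set} (f : A → B → C) xs ys →
  length (cartesianProductWith f xs ys) ≡ length xs * length ys
length-cartesianProductWith f []       ys = ≡.refl
length-cartesianProductWith f (x ∷ xs) ys = ≡.trans (List.length-++ (map (f x) ys))
  (≡.cong₂ _+_ (List.length-map (f x) ys) (length-cartesianProductWith f xs ys))

-- Pigeonhole: were every index related to an entry, its position in `xs` would determine it, giving
-- an injection of `Fin N` into too few positions. A relation stands in for equality because columns
-- are compared only entrywise up to `≈`.
unrelated : ∀ {N} {A : Set} {R : Fin N → A → Set} → (∀ i a → Dec (R i a)) →
            (∀ {i j a} → R i a → R j a → i ≡ j) →
            ∀ xs → length xs < N → ∃ λ i → ¬ Any (R i) xs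
unrelated {N} {R = R} R? R-inj xs xs<N with any? (λ i → ¬? (Any.any? (R? i) xs))
... | yes found = found
... | no  none  = contradiction xs<N (ℕ.≤⇒≯ (injective⇒≤ position-injective))
  where
  related : ∀ i → Any (R i) xs
  related i = decidable-stable (Any.any? (R? i) xs) λ ¬r → none (i , ¬r)
  position-injective : ∀ {i j} → Any.index (related i) ≡ Any.index (related j) → i ≡ j
  position-injective {i} {j} eq = R-inj (lookup-index (related i))
    (≡.subst (R j) (≡.cong (lookup xs) (≡.sym eq)) (lookup-index (related j)))

C-mono-suc : ∀ n k → n C k ≤ suc n C k
C-mono-suc n zero    = ℕ.≤-refl
C-mono-suc n (suc k) = ≡.subst (n C suc k ≤_) (nCk+nC[k+1]≡[n+1]C[k+1] n k) (ℕ.m≤n+m _ _)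

C-monoˡ-≤ : ∀ {m n} k → m ≤ n → m C k ≤ n C k
C-monoˡ-≤ {m} {n} k m≤n = ≡.subst (λ z → m C k ≤ z C k) (ℕ.m∸n+n≡m m≤n) (go (n ∸ m))
  where
  go : ∀ l → m C k ≤ (l + m) C k
  go zero    = ℕ.≤-refl
  go (suc l) = ℕ.≤-trans (go l) (C-mono-suc (l + m) k)

-- Parity-check columns and the syndrome colouring.

module ParityCheck (K : Field) {q-1 : ℕ} (E : Enumeration K (suc q-1)) (k : ℕ) where
  open Field K using (Carrier; _≈_; 0#; 1#; _-_; -_; _≟_; inverse; setoid; commutativeRing; ring;
    +-cong; +-congˡ; +-congʳ; *-congˡ; *-congʳ; +-identityˡ; *-assoc; *-comm; *-identityˡ;
    zeroˡ; zeroʳ; distribˡ; -‿inverseʳ; -‿cong; 1≉0; refl; sym; trans; reflexive)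
    renaming (_+_ to _⊞_; _*_ to _⊠_)
  open FieldProperties K
  open Enumeration E
  open import Algebra.Properties.Ring ring
  open import Algebra.Properties.CommutativeSemigroup (CommutativeRing.+-commutativeSemigroup commutativeRing)
    using (interchange)

  q N : ℕ
  q = suc q-1
  N = q ^ k

  Column : Set
  Column = Fin k → Carrier

  infix 4 _≋_
  _≋_ : Column → Column → Set
  v ≋ w = ∀ i → v i ≈ w i

  toColumn : Fin N → Column
  toColumn c i = from (finToFun c i)

  toColour : Column → Fin N
  toColour v = funToFin (to ∘ v)

  from-injective : ∀ {i j} → from i ≈ from j → i ≡ j
  from-injective {i} {j} e = ≡.trans (≡.sym (to-from i)) (≡.trans (to-cong e) (to-from j))

  to-injective : ∀ {x y} → to x ≡ to y → x ≈ y
  to-injective {x} {y} e = trans (sym (from-to x)) (trans (reflexive (≡.cong from e)) (from-to y))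

  toColumn-injective : ∀ {c d} → toColumn c ≋ toColumn d → c ≡ d
  toColumn-injective {c} {d} e = ≡.trans (≡.sym (funToFin-finToFin {k} c))
    (≡.trans (funToFin-cong (λ i → from-injective (e i))) (funToFin-finToFin {k} d))

  toColour-injective : ∀ {v w} → toColour v ≡ toColour w → v ≋ w
  toColour-injective {v} {w} e i = to-injective (≡.trans (≡.sym (finToFun-funToFin (to ∘ v) i))
    (≡.trans (≡.cong (λ c → finToFun c i) e) (finToFun-funToFin (to ∘ w) i)))

  weight : ∀ {n} → (Fin n → Carrier) → ℕ
  weight {zero}  c = 0
  weight {suc n} c with c zero ≟ 0#
  ... | yes _ = weight (c ∘ suc)
  ... | no  _ = suc (weight (c ∘ suc))

  syndrome : ∀ {n} → (Fin n → Carrier) → (Fin n → Column) → Column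
  syndrome {zero}  c h i = 0#
  syndrome {suc n} c h i = c zero ⊠ h zero i ⊞ syndrome (c ∘ suc) (h ∘ suc) i

  syndrome-* : ∀ {n} a c (h : Fin n → Column) i → syndrome (λ j → a ⊠ c j) h i ≈ a ⊠ syndrome c h i
  syndrome-* {zero}  a c h i = sym (zeroʳ a)
  syndrome-* {suc n} a c h i = trans
    (+-cong (*-assoc a _ _) (syndrome-* a (c ∘ suc) (h ∘ suc) i)) (sym (distribˡ a _ _))

  syndrome-∸ : ∀ {n} c d (h : Fin n → Column) i →
               syndrome (λ j → c j - d j) h i ≈ syndrome c h i - syndrome d h i
  syndrome-∸ {zero}  c d h i = sym (-‿inverseʳ 0#)
  syndrome-∸ {suc n} c d h i = begin
    (c zero - d zero) ⊠ x ⊞ syndrome (λ j → c (suc j) - d (suc j)) (h ∘ suc) i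
      ≈⟨ +-cong ([y-z]x≈yx-zx x (c zero) (d zero)) (syndrome-∸ (c ∘ suc) (d ∘ suc) (h ∘ suc) i) ⟩
    (c zero ⊠ x - d zero ⊠ x) ⊞ (s - s′)
      ≈⟨ interchange _ _ _ _ ⟩
    (c zero ⊠ x ⊞ s) ⊞ (- (d zero ⊠ x) - s′)
      ≈⟨ +-congˡ (-‿+-comm _ _) ⟩
    (c zero ⊠ x ⊞ s) - (d zero ⊠ x ⊞ s′) ∎
    where
    open import Relation.Binary.Reasoning.Setoid setoid
    x = h zero i
    s = syndrome (c ∘ suc) (h ∘ suc) i
    s′ = syndrome (d ∘ suc) (h ∘ suc) i

  syndrome-zero-head : ∀ {n} (c : Fin (suc n) → Carrier) h → c zero ≈ 0# →
                       syndrome c h ≋ syndrome (c ∘ suc) (h ∘ suc)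
  syndrome-zero-head c h c₀≈0 i = trans (+-congʳ (trans (*-congʳ c₀≈0) (zeroˡ _))) (+-identityˡ _)

  weight-* : ∀ {n a} → ¬ a ≈ 0# → (c : Fin n → Carrier) → weight (λ j → a ⊠ c j) ≡ weight c
  weight-* {zero}      a≉0 c = ≡.refl
  weight-* {suc n} {a} a≉0 c with (a ⊠ c zero) ≟ 0# | c zero ≟ 0#
  ... | yes _    | yes _    = weight-* a≉0 (c ∘ suc)
  ... | no  _    | no  _    = ≡.cong suc (weight-* a≉0 (c ∘ suc))
  ... | yes ac≈0 | no  c≉0  = contradiction (integral a≉0 ac≈0) c≉0
  ... | no  ac≉0 | yes c≈0  = contradiction (trans (*-congˡ c≈0) (zeroʳ a)) ac≉0

  -- The bridge from `Fin q` to the field: `from` is injective, so a difference of letters vanishes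
  -- exactly where the letters agree.
  weight-difference : ∀ {n} (x y : Word n q) → weight (λ i → from (x i) - from (y i)) ≡ hamming x y
  weight-difference {zero}  x y = ≡.refl
  weight-difference {suc n} x y with (from (x zero) - from (y zero)) ≟ 0# | x zero ≟F y zero
  ... | yes _   | yes _   = weight-difference (x ∘ suc) (y ∘ suc)
  ... | no  _   | no  _   = ≡.cong suc (weight-difference (x ∘ suc) (y ∘ suc))
  ... | yes e   | no  x≢y = contradiction (from-injective (x-y≈0⇒x≈y e)) x≢y
  ... | no  e   | yes x≡y = contradiction (trans (+-congʳ (reflexive (≡.cong from x≡y))) (-‿inverseʳ _)) e

  nonzero : Fin q-1 → Carrier
  nonzero i = from (punchIn (to 0#) i)

  nonzero-surjective : ∀ {x} → ¬ x ≈ 0# → ∃ λ i → x ≈ nonzero i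
  nonzero-surjective {x} x≉0 = punchOut to0≢tox ,
    trans (sym (from-to x)) (reflexive (≡.cong from (≡.sym (punchIn-punchOut to0≢tox))))
    where
    to0≢tox : ¬ to 0# ≡ to x
    to0≢tox e = x≉0 (sym (to-injective e))

  -- The two parts of the list have zero and nonzero coefficient at the first column. This mirrors
  -- Pascal's rule, so the length is exactly (n C j) (q - 1)^j; different choices with the same
  -- value are listed separately.
  combinations : ∀ {n} → ℕ → (Fin n → Column) → List Column
  combinations         zero    h = [ (λ _ → 0#) ]
  combinations {zero}  (suc j) h = []
  combinations {suc n} (suc j) h = combinations (suc j) (h ∘ suc) ++
    cartesianProductWith (λ a v i → nonzero a ⊠ h zero i ⊞ v i) (allFin q-1) (combinations j (h ∘ suc))

  length-combinations : ∀ {n} j (h : Fin n → Column) → length (combinations j h) ≡ (n C j) * q-1 ^ j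
  length-combinations         zero    h = ≡.refl
  length-combinations {zero}  (suc j) h = ≡.cong (_* q-1 ^ suc j) (≡.sym (k>n⇒nCk≡0 {0} {suc j} (s≤s z≤n)))
  length-combinations {suc n} (suc j) h = begin
    length (combinations (suc j) h′ ++ products)  ≡⟨ List.length-++ (combinations (suc j) h′) ⟩
    length (combinations (suc j) h′) + length products
      ≡⟨ ≡.cong₂ _+_ (length-combinations (suc j) h′)
           (≡.trans (length-cartesianProductWith _ (allFin q-1) (combinations j h′))
             (≡.cong₂ _*_ (List.length-tabulate {n = q-1} (λ i → i)) (length-combinations j h′))) ⟩
    (n C suc j) * q-1 ^ suc j + q-1 * ((n C j) * q-1 ^ j)
      ≡⟨ ≡.cong ((n C suc j) * q-1 ^ suc j +_) (x∙yz≈y∙xz q-1 (n C j) (q-1 ^ j)) ⟩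
    (n C suc j) * q-1 ^ suc j + (n C j) * q-1 ^ suc j
      ≡⟨ ℕ.*-distribʳ-+ (q-1 ^ suc j) (n C suc j) (n C j) ⟨
    ((n C suc j) + (n C j)) * q-1 ^ suc j
      ≡⟨ ≡.cong (_* q-1 ^ suc j) (≡.trans (ℕ.+-comm (n C suc j) _) (nCk+nC[k+1]≡[n+1]C[k+1] n j)) ⟩
    (suc n C suc j) * q-1 ^ suc j ∎
    where
    open ≡.≡-Reasoning
    open import Algebra.Properties.CommutativeSemigroup ℕ.*-commutativeSemigroup using (x∙yz≈y∙xz)
    h′ = h ∘ suc
    products = cartesianProductWith (λ a v i → nonzero a ⊠ h zero i ⊞ v i) (allFin q-1) (combinations j h′)

  syndrome-weight-0 : ∀ {n} c (h : Fin n → Column) → weight c ≡ 0 → ∀ i → syndrome c h i ≈ 0#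
  syndrome-weight-0 {zero}  c h _  i = refl
  syndrome-weight-0 {suc n} c h w≡0 i with c zero ≟ 0#
  ... | yes c₀≈0 = trans (syndrome-zero-head c h c₀≈0 i) (syndrome-weight-0 (c ∘ suc) (h ∘ suc) w≡0 i)

  combinations-complete : ∀ {n} j c (h : Fin n → Column) → weight c ≡ j →
                          Any (syndrome c h ≋_) (combinations j h)
  combinations-complete         zero    c h w≡j = here (syndrome-weight-0 c h w≡j)
  combinations-complete {suc n} (suc j) c h w≡j with c zero ≟ 0#
  ... | yes c₀≈0 = ++⁺ˡ (Any.map (λ e i → trans (syndrome-zero-head c h c₀≈0 i) (e i))
    (combinations-complete (suc j) (c ∘ suc) (h ∘ suc) w≡j))
  ... | no  c₀≉0 with a , c₀≈a ← nonzero-surjective c₀≉0 = ++⁺ʳ (combinations (suc j) (h ∘ suc))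
    (cartesianProductWith⁺ _ (λ e f i → +-cong (*-congʳ (trans c₀≈a (reflexive (≡.cong nonzero e)))) (f i))
      (∈-allFin a) (combinations-complete j (c ∘ suc) (h ∘ suc) (ℕ.suc-injective w≡j)))

  Separates : ∀ {n} → ℕ → (Fin n → Column) → Set
  Separates d h = ∀ c → weight c ≡ d → ¬ (∀ i → syndrome c h i ≈ 0#)

  extend : ∀ {n} → Column → (Fin n → Column) → Fin (suc n) → Column
  extend v h zero    = v
  extend v h (suc j) = h j

  -- A vanishing combination that uses v can be solved for it: v = -c₀⁻¹ s, where s is the
  -- contribution of the old columns. Scaling by a nonzero factor preserves the weight j, so v would
  -- be one of the listed combinations.
  extend-separates : ∀ {n j} v (h : Fin n → Column) → Separates (suc j) h →
                     ¬ Any (v ≋_) (combinations j h) → Separates (suc j) (extend v h)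
  extend-separates {n} {j} v h sep v∉ c w≡d s≈0 with c zero ≟ 0#
  ... | yes c₀≈0 = sep (c ∘ suc) w≡d λ i → trans (sym (syndrome-zero-head c (extend v h) c₀≈0 i)) (s≈0 i)
  ... | no  c₀≉0 with a , c₀a≈1 ← inverse c₀≉0 = v∉ (Any.map (λ e i → trans (v≈ i) (e i))
    (combinations-complete j (λ l → - a ⊠ c (suc l)) h (≡.trans (weight-* -a≉0 (c ∘ suc)) (ℕ.suc-injective w≡d))))
    where
    -a≉0 : ¬ - a ≈ 0#
    -a≉0 -a≈0 = 1≉0 (trans (sym c₀a≈1) (trans (*-congˡ (trans (sym (-‿involutive a)) (trans (-‿cong -a≈0) -0#≈0#))) (zeroʳ _)))
    v≈ : ∀ i → v i ≈ syndrome (λ l → - a ⊠ c (suc l)) h i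
    v≈ i = begin
      v i                       ≈⟨ *-identityˡ (v i) ⟨
      1# ⊠ v i                  ≈⟨ *-congʳ (trans (*-comm a (c zero)) c₀a≈1) ⟨
      (a ⊠ c zero) ⊠ v i        ≈⟨ *-assoc a _ _ ⟩
      a ⊠ (c zero ⊠ v i)        ≈⟨ *-congˡ (+-inverseˡ-unique _ _ (s≈0 i)) ⟩
      a ⊠ - s                   ≈⟨ -‿distribʳ-* a s ⟨
      - (a ⊠ s)                 ≈⟨ -‿distribˡ-* a s ⟩
      - a ⊠ s                   ≈⟨ syndrome-* (- a) (c ∘ suc) h i ⟨
      syndrome (λ l → - a ⊠ c (suc l)) h i ∎
      where
      open import Relation.Binary.Reasoning.Setoid setoid
      s = syndrome (c ∘ suc) h i

  separating-columns : ∀ n j → (∀ {l} → l < n → (l C j) * q-1 ^ j < N) →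
                       ∃ λ (h : Fin n → Column) → Separates (suc j) h
  -- Without columns the weight is 0, never `suc j`.
  separating-columns zero    j few = (λ ()) , λ _ ()
  separating-columns (suc n) j few
    with h , sep ← separating-columns n j (λ l<n → few (ℕ.m<n⇒m<1+n l<n))
    with c , c∉ ← unrelated {R = λ c v → toColumn c ≋ v} (λ c v → all? λ i → toColumn c i ≟ v i)
           (λ e f → toColumn-injective (λ i → trans (e i) (sym (f i))))
           (combinations j h) (≡.subst (_< N) (≡.sym (length-combinations j h)) (few ℕ.≤-refl))
    = extend (toColumn c) h , extend-separates (toColumn c) h sep c∉

  colouring : ∀ n j → (n C j) * q-1 ^ j < N → χ≤ (suc j) (suc n) q N
  colouring n j few with h , sep ← separating-columns (suc n) j
      -- The last column has the most combinations to avoid, so the bound at n covers every earlier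
      -- step l ≤ n.
      (λ l<1+n → ℕ.≤-<-trans (ℕ.*-monoˡ-≤ (q-1 ^ j) (C-monoˡ-≤ j (ℕ.≤-pred l<1+n))) few) =
    (λ x → toColour (syndrome (from ∘ x) h)) ,
    -- By linearity, equal colours make the syndrome of the difference vanish, while the distance
    -- makes its weight `suc j`.
    λ x y dist same → sep (λ i → from (x i) - from (y i)) (≡.trans (weight-difference x y) dist)
      λ i → trans (syndrome-∸ (from ∘ x) (from ∘ y) h i)
        (trans (+-congʳ (toColour-injective same i)) (-‿inverseʳ _))

theorem3p4 : (q n d : ℕ) → IsPrimePower q → n ≥ 1 → d ≥ 1 → (k : ℕ)
    → IsCeilLog q (2 + ((n ∸ 1) C (d ∸ 1)) * (q ∸ 1) ^ (d ∸ 1)) k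
    → χ≤ d n q (q ^ k)
theorem3p4 q (suc n) (suc j) (p , e , p-prime , q≡p^e) _ _ k (bound , _) =
  go q (≡.subst (Enumeration K) (≡.sym q≡p^e) E) bound
  where
  K = proj₁ (finite-field p-prime e)
  E = proj₂ (finite-field p-prime e)
  go : ∀ q → Enumeration K q → 2 + (n C j) * (q ∸ 1) ^ j ≤ q ^ k → χ≤ (suc j) (suc n) q (q ^ k)
  go zero      E _     = contradiction (Enumeration.to E (Field.0# K)) λ ()
  -- Writing X for the number of combinations, `2 + X ≤ q ^ k` reads `suc X < q ^ k`; its weak form
  -- `suc X ≤ q ^ k` is the strict inequality `X < q ^ k` that the greedy choice asks for.
  go (suc q-1) E bound = ParityCheck.colouring K E k n j (ℕ.<⇒≤ bound)
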